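{- Let $(G,\pi_0)$ be a colored graph and let $(G',\pi')=C(G,\pi_0)$ be its canonical form. Then there exists a proof for $(G,\pi_0)$ (in the proof system described in the context) that derives the fact $C(G,\pi_0)=(G',\pi')$.
   Context: Graphs and colorings: $G=(V,E)$ is a finite undirected graph with $V=\{1,\dots,n\}$. A coloring of $G$ is a surjective map $\pi:V\to\{1,\dots,m\}$. The set $\pi^{ -1}(k)$ is its $k$-th cell. $\pi$ is identified with the ordered sequence of its cells, and $(G,\pi)$ is called a colored graph. The relation $\pi'\preceq\pi$ means that $\pi(u)<\pi(v)$ implies $\pi'(u)<\pi'(v)$ for all $u,v$. The relation $\pi'\prec\pi$ means $\pi'\preceq\pi$ and $\pi'\ne\pi$. A coloring is discrete if all its cells are singletons; a discrete coloring is a permutation of $V$. A permutation $\sigma$ of $V$ acts as follows: - $G^\sigma=(V,\{(u^\sigma,v^\sigma):(u,v)\in E\})$; - $\pi^\sigma(v^\sigma)=\pi(v)$, so the cells are mapped in the same order; - on vertex sets and vertex sequences, elementwise. $Aut(G,\pi)=\{\sigma: G^\sigma=G,\pi^\sigma=\pi\}$. For a discrete coloring $\pi$, viewed as a permutation, $G^\pi$ and $\pi_0^\pi$ are the images under it. For $\nu=[v_1,\dots,v_k]$: $|\nu|=k$, $[\nu]_i=[v_1,\dots,v_i]$, $[\nu,w]=[v_1,\dots,v_k,w]$; $<_{lex}$ is the lexicographic order. Refinement: the procedure make\_equitable$(G,\pi,\alpha)$, with $\alpha$ a list of cells of $\pi$, works as follows. Set $\pi':=\pi$. While $\pi'$ is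 not discrete and $\alpha\neq\emptyset$: 1. Let $W$ be the first cell of $\pi'$ that lies in $\alpha$. Remove $W$ from $\alpha$. 2. For each non-singleton cell $X$ of $\pi'$: - partition $X$ into the classes $X_1,\dots,X_k$ of vertices with equal numbers of neighbours in $W$, ordered by increasing number; - let $j$ be the smallest index with $|X_j|$ maximal; - replace $X$ in place by $X_1,\dots,X_{j-1},X_{j+1},\dots,X_k,X_j$; - add each $X_i$ ($i\neq j$) to $\alpha$, and if $X\in\alpha$, replace it in $\alpha$ by $X_j$. Return $\pi'$. The refinement function $\bar R$ is defined recursively: - $\bar R(G,\pi_0,[\,])=$ make\_equitable$(G,\pi_0,\text{all cells of }\pi_0)$; - $\bar R(G,\pi_0,[\nu',v])$ = make\_equitable$(G,\pi'',[\{v\}])$, where $\pi''$ is $\bar R(G,\pi_0,\nu')$ with the cell $W\ni v$ replaced in place by $\{v\},W\setminus\{v\}$. Search tree: $\bar T(G,\pi_0,\nu)$ is the first non-singleton cell of $\bar R(G,\pi_0,\nu)$, or $\emptyset$. The search tree $\mathcal T(G,\pi_0)$ has root $[\,]$; the children of $\nu$ are $[\nu,w]$ for $w\in\bar T(G,\pi_0,\nu)$, in increasing order. The leaves are the nodes with $\bar R(G,\pi_0,\nu)$ discrete, and $G_\nu=G^{\bar R(G,\pi_0,\nu)}$. Invariants: fix a function hash from colored graphs to a totally ordered set with hash$(G^\sigma,\pi^\sigma)=$hash$(G,\pi)$ for all $\sigma$. Define $\bar\phi(G,\pi_0,[v_1,\dots,v_k])=[h_1,\dots,h_k]$ with $h_i=$hash$(G,\bar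 R(G,\pi_0,[v_1,\dots,v_i]))$, compared lexicographically (a proper prefix is smaller). Canonical form: fix a total order on graphs with vertex set $V$. Maximal leaves are the leaves of maximal invariant. Let $G_{max}$ be the largest $G_\nu$ over maximal leaves. The canonical leaf $\nu^*$ is the lexicographically smallest maximal leaf with $G_{\nu^*}=G_{max}$, and $C(G,\pi_0)=(G^{\pi^*},\pi_0^{\pi^*})$ with $\pi^*=\bar R(G,\pi_0,\nu^*)$. Proof system for a fixed $(G,\pi_0)$. Facts are the formal expressions: - $\bar R(G,\pi_0,\nu)=\pi$; - $\bar R(G,\pi_0,\nu)\preceq\pi$; - $\bar T(G,\pi_0,\nu)=W$; - $\Omega\vartriangleleft\operatorname{orbits}(G,\pi_0,\nu)$; - $\bar\phi(G,\pi_0,\nu')=\bar\phi(G,\pi_0,\nu'')$; - $\operatorname{pruned}(G,\pi_0,\nu)$; - $\operatorname{on\_path}(G,\pi_0,\nu)$; - $C(G,\pi_0)=(G',\pi')$. Auxiliary functions: - $\operatorname{ind}(\pi,v)$ replaces the cell $W\ni v$ in place by $\{v\},W\setminus\{v\}$; - $\operatorname{split}(G,\pi,i)$ replaces each cell $X$ by the fragments of vertices with equal numbers of neighbours in the $i$-th cell of $\pi$, sorted ascending by that number, with the first fragment of maximal size moved to the end; - $\operatorname{cell}_j(\pi)$ is the $j$-th cell. A proof is a finite sequence of rule applications; each rule's premises must be derived earlier, and its side conditions must hold. The rules ($G,\pi_0$ omitted): - ColoringAxiom: $\Rightarrow\bar R([\,])\preceq\pi_0$. - Individualize: $\bar R(\nu)=\pi\Rightarrow\bar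 R([\nu,v])\preceq\operatorname{ind}(\pi,v)$. - SplitColoring: $\bar R(\nu)\preceq\pi\Rightarrow\bar R(\nu)\preceq\operatorname{split}(G,\pi,i)$ with $i=\min\{j:\operatorname{split}(G,\pi,j)\prec\pi\}$ [it exists]. - Equitable: $\bar R(\nu)\preceq\pi\Rightarrow\bar R(\nu)=\pi$ [$\operatorname{split}(G,\pi,i)=\pi$ for all $i$]. - TargetCell: $\bar R(\nu)=\pi\Rightarrow\bar T(\nu)=\operatorname{cell}_i(\pi)$ with $i=\min\{j:|\operatorname{cell}_j(\pi)|>1\}$ [it exists]. - InvariantAxiom: $\Rightarrow\bar\phi(\nu)=\bar\phi(\nu)$. - InvariantsEqual: $\bar\phi(\nu')=\bar\phi(\nu'')$, $\bar R([\nu',v'])=\pi_1$, $\bar R([\nu'',v''])=\pi_2\Rightarrow\bar\phi([\nu',v'])=\bar\phi([\nu'',v''])$ [hash$(G,\pi_1)=$hash$(G,\pi_2)$]. - InvariantsEqualSym: $\bar\phi(\nu')=\bar\phi(\nu'')\Rightarrow\bar\phi(\nu'')=\bar\phi(\nu')$. - OrbitsAxiom: $\Rightarrow\{v\}\vartriangleleft\operatorname{orbits}(\nu)$. - MergeOrbits: $\Omega_1\vartriangleleft\operatorname{orbits}(\nu)$, $\Omega_2\vartriangleleft\operatorname{orbits}(\nu)\Rightarrow\Omega_1\cup\Omega_2\vartriangleleft\operatorname{orbits}(\nu)$ [there are $\sigma\in Aut(G,\pi_0)$ with $\nu^\sigma=\nu$ and $w_1\in\Omega_1$, $w_2\in\Omega_2$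 with $w_1^\sigma=w_2$]. - PruneInvariant: $\bar\phi(\nu')=\bar\phi(\nu'')$, $\bar R([\nu',v'])=\pi_1$, $\bar R([\nu'',v''])=\pi_2\Rightarrow\operatorname{pruned}([\nu'',v''])$ [hash$(G,\pi_1)>$hash$(G,\pi_2)$]. - PruneLeaf: $\bar R(\nu')=\pi_1$, $\bar R(\nu'')=\pi_2$, $\bar\phi(\nu')=\bar\phi(\nu'')\Rightarrow\operatorname{pruned}(\nu'')$ [$\pi_2$ discrete, and ($\pi_1$ not discrete or $G^{\pi_1}>G^{\pi_2}$)]. - PruneAutomorphism: $\Rightarrow\operatorname{pruned}(\nu'')$ [there are $\nu'<_{lex}\nu''$ and $\sigma\in Aut(G,\pi_0)$ with $\nu'^\sigma=\nu''$]. - PruneOrbits: $\Omega\vartriangleleft\operatorname{orbits}(\nu)\Rightarrow\operatorname{pruned}([\nu,w_2])$ [$w_2\in\Omega$ and some $w_1\in\Omega$ has $w_1<w_2$]. - PruneParent: $\bar T(\nu)=W$ and $\operatorname{pruned}([\nu,w])$ for all $w\in W\Rightarrow\operatorname{pruned}(\nu)$. - PathAxiom: $\Rightarrow\operatorname{on\_path}([\,])$. - ExtendPath: $\operatorname{on\_path}(\nu)$, $\bar T(\nu)=W$, $\operatorname{pruned}([\nu,w'])$ for all $w'\in W\setminus\{w\}\Rightarrow\operatorname{on\_path}([\nu,w])$. - CanonicalLeaf: $\operatorname{on\_path}(\nu)$, $\bar R(\nu)=\pi\Rightarrow C(G,\pi_0)=(G^\pi,\pi_0^\pi)$ [$\pi$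 discrete]. -}

module Defs where

open import Level using (0ℓ)
open import Data.Bool using (Bool; true; false; _∧_; _∨_; not; if_then_else_; T)
open import Data.Nat using (ℕ; zero; suc; _+_; _*_; _<_; _≤_; _≡ᵇ_; _≤ᵇ_; _⊔_)
open import Data.Fin using (Fin; toℕ)
import Data.Fin as Fin
open import Data.Fin.Subset using (Subset; ⁅_⁆; ∣_∣; Nonempty; _∪_; _─_; _∈_)
  renaming (⊥ to ∅)
open import Data.Fin.Permutation using (Permutation′; _⟨$⟩ʳ_)
open import Data.Vec using (Vec; lookup; tabulate)
open import Data.Vec.Properties using (≡-dec)
open import Data.List using (List; []; _∷_; [_]; _++_; _∷ʳ_; map; concatMap; filter;
  length; reverse; inits; drop; allFin; foldr; upTo)
open import Data.Bool.ListAction using (any; all)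
open import Data.List.Relation.Unary.All using (All)
open import Data.List.Relation.Binary.Lex.Core using (Lex-<)
open import Data.Product using (_×_; _,_; Σ; ∃; proj₁; proj₂)
open import Data.Sum using (_⊎_)
open import Data.Maybe using (Maybe; just; nothing)
open import Relation.Binary.PropositionalEquality using (_≡_; _≢_)
open import Relation.Binary.Core using (Rel)
open import Relation.Nullary using (¬_; does)
import Data.Bool.Properties as BoolP

-- Basic objects.  Vertices are Fin n (vertex k+1 of the paper is the
-- Fin-index k; the order is the same).

Graph : ℕ → Set
Graph n = Vec (Vec Bool n) n

adj : ∀ {n} → Graph n → Fin n → Fin n → Bool
adj G u v = lookup (lookup G u) v

Symmetric : ∀ {n} → Graph n → Set
Symmetric G = ∀ u v → adj G u v ≡ adj G v u

-- A coloring, identified with the ordered sequence of its cells.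
Coloring : ℕ → Set
Coloring n = List (Subset n)

cellsContaining : ∀ {n} → Coloring n → Fin n → ℕ
cellsContaining π v = length (filter (λ c → lookup c v BoolP.≟ true) π)

-- π is a genuine coloring (surjective map onto {1..m}): its cells are
-- nonempty and every vertex lies in exactly one cell.
IsColoring : ∀ {n} → Coloring n → Set
IsColoring π = All Nonempty π × (∀ v → cellsContaining π v ≡ 1)

-- π(v), 0-based: index of the (first) cell containing v.
col : ∀ {n} → Coloring n → Fin n → ℕ
col [] v = 0
col (c ∷ cs) v = if lookup c v then 0 else suc (col cs v)

_⪯_ : ∀ {n} → Coloring n → Coloring n → Set
π' ⪯ π = ∀ u v → col π u < col π v → col π' u < col π' v

_≺_ : ∀ {n} → Coloring n → Coloring n → Set
π' ≺ π = (π' ⪯ π) × (π' ≢ π)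

Discrete : ∀ {n} → Coloring n → Set
Discrete π = All (λ c → ∣ c ∣ ≡ 1) π

isDiscrete : ∀ {n} → Coloring n → Bool
isDiscrete π = all (λ c → ∣ c ∣ ≡ᵇ 1) π

-- Action of a vertex map f : V → ℕ (target vertex index), by images.
-- Used both for permutations σ and for discrete colorings viewed as
-- permutations v ↦ π(v).

anyV : ∀ {n} → (Fin n → Bool) → Bool
anyV {n} p = any p (allFin n)

actG : ∀ {n} → (Fin n → ℕ) → Graph n → Graph n
actG f G = tabulate λ x → tabulate λ y →
  anyV λ u → anyV λ v → (f u ≡ᵇ toℕ x) ∧ ((f v ≡ᵇ toℕ y) ∧ adj G u v)

actS : ∀ {n} → (Fin n → ℕ) → Subset n → Subset n
actS f S = tabulate λ x → anyV λ u → (f u ≡ᵇ toℕ x) ∧ lookup S u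

actC : ∀ {n} → (Fin n → ℕ) → Coloring n → Coloring n
actC f π = map (actS f) π

permMap : ∀ {n} → Permutation′ n → Fin n → ℕ
permMap σ v = toℕ (σ ⟨$⟩ʳ v)

-- G^π, π0^π for a (discrete) coloring π viewed as permutation v ↦ π(v)
graphBy : ∀ {n} → Coloring n → Graph n → Graph n
graphBy π G = actG (col π) G

colBy : ∀ {n} → Coloring n → Coloring n → Coloring n
colBy π π₀ = actC (col π) π₀

IsAut : ∀ {n} → Graph n → Coloring n → Permutation′ n → Set
IsAut G π₀ σ = (actG (permMap σ) G ≡ G) × (actC (permMap σ) π₀ ≡ π₀)

HashInvariant : ∀ {n} {H : Set} → (Graph n → Coloring n → H) → Set
HashInvariant {n} hash = ∀ (σ : Permutation′ n) G π →
  hash (actG (permMap σ) G) (actC (permMap σ) π) ≡ hash G π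

_==S_ : ∀ {n} → Subset n → Subset n → Bool
X ==S Y = does (≡-dec BoolP._≟_ X Y)

nbrs : ∀ {n} → Graph n → Subset n → Fin n → ℕ
nbrs {n} G W x = length (filter (λ u → (lookup W u ∧ adj G x u) BoolP.≟ true) (allFin n))

fragment : ∀ {n} → Graph n → Subset n → Subset n → ℕ → Subset n
fragment G W X k = tabulate λ x → lookup X x ∧ (nbrs G W x ≡ᵇ k)

fragments : ∀ {n} → Graph n → Subset n → Subset n → List (Subset n)
fragments {n} G W X =
  filter (λ F → (1 ≤ᵇ ∣ F ∣) BoolP.≟ true) (map (fragment G W X) (upTo (suc n)))

maxSize : ∀ {n} → List (Subset n) → ℕ
maxSize = foldr (λ F m → ∣ F ∣ ⊔ m) 0

extract : ∀ {n} → ℕ → List (Subset n) → List (Subset n) × Subset n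
extract m [] = [] , ∅
extract m (F ∷ Fs) with ∣ F ∣ ≡ᵇ m
... | true = Fs , F
... | false = let r = extract m Fs in (F ∷ proj₁ r) , proj₂ r

shatter : ∀ {n} → Graph n → Subset n → Subset n → List (Subset n) × Subset n
shatter G W X = let Fs = fragments G W X in extract (maxSize Fs) Fs

refineCell : ∀ {n} → Graph n → Subset n → Subset n → List (Subset n)
refineCell G W X = proj₁ (shatter G W X) ∷ʳ proj₂ (shatter G W X)

split : ∀ {n} → Graph n → (π : Coloring n) → Fin (length π) → Coloring n
split G π i = concatMap (refineCell G (Data.List.lookup π i)) π

cell : ∀ {n} (π : Coloring n) → Fin (length π) → Subset n
cell π i = Data.List.lookup π i

ind : ∀ {n} → Coloring n → Fin n → Coloring n
ind π v = concatMap step π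
  where
  step : _ → List _
  step W = if lookup W v
           then (⁅ v ⁆ ∷ (if ∣ W ─ ⁅ v ⁆ ∣ ≡ᵇ 0 then [] else [ W ─ ⁅ v ⁆ ]))
           else [ W ]

memS : ∀ {n} → Subset n → List (Subset n) → Bool
memS X α = any (X ==S_) α

removeFirst : ∀ {n} → Subset n → List (Subset n) → List (Subset n)
removeFirst X [] = []
removeFirst X (Y ∷ Ys) = if X ==S Y then Ys else Y ∷ removeFirst X Ys

replaceS : ∀ {n} → Subset n → Subset n → List (Subset n) → List (Subset n)
replaceS X Z α = map (λ Y → if Y ==S X then Z else Y) α

firstIn : ∀ {n} → Coloring n → List (Subset n) → Maybe (Subset n)
firstIn [] α = nothing
firstIn (X ∷ π) α = if memS X α then just X else firstIn π α

refineAll : ∀ {n} → Graph n → Subset n → Coloring n → List (Subset n)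
          → Coloring n × List (Subset n)
refineAll G W [] α = [] , α
refineAll G W (X ∷ π) α with ∣ X ∣ ≤ᵇ 1
... | true = let r = refineAll G W π α in (X ∷ proj₁ r) , proj₂ r
... | false =
  let s  = shatter G W X
      α₁ = (if memS X α then replaceS X (proj₂ s) α else α) ++ proj₁ s
      r  = refineAll G W π α₁
  in (proj₁ s ++ proj₂ s ∷ proj₁ r) , proj₂ r

-- the while loop, with fuel (each round removes one element of α and
-- adds as many as new cells are created, so at most length α + n rounds
-- are ever needed; the fuel below is far larger)
loop : ∀ {n} → ℕ → Graph n → Coloring n → List (Subset n) → Coloring n
loop zero G π α = π
loop (suc f) G π [] = π
loop (suc f) G π (A ∷ α) with isDiscrete π | firstIn π (A ∷ α)
... | true | _ = π
... | false | nothing = π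
... | false | just W =
  let r = refineAll G W π (removeFirst W (A ∷ α)) in loop f G (proj₁ r) (proj₂ r)

makeEquitable : ∀ {n} → Graph n → Coloring n → List (Subset n) → Coloring n
makeEquitable {n} G π α = loop (suc (length α + n) * suc n) G π α

Seq : ℕ → Set
Seq n = List (Fin n)

data Fact (n : ℕ) : Set where
  R≡     : Seq n → Coloring n → Fact n
  R⪯     : Seq n → Coloring n → Fact n
  T≡     : Seq n → Subset n → Fact n
  orbit  : Subset n → Seq n → Fact n
  φ≡     : Seq n → Seq n → Fact n
  pruned : Seq n → Fact n
  onPath : Seq n → Fact n
  C≡     : Graph n → Coloring n → Fact n

_<V_ : ∀ {n} → Fin n → Fin n → Set
u <V v = toℕ u < toℕ v

-- lexicographic order on vertex sequences (a proper prefix is smaller)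
_<lex_ : ∀ {n} → Seq n → Seq n → Set
_<lex_ = Lex-< _≡_ _<V_

module Canon {n : ℕ} (G : Graph n) (π₀ : Coloring n)
             {H : Set} (_<H_ : Rel H 0ℓ) (hash : Graph n → Coloring n → H)
             (_<G_ : Rel (Graph n) 0ℓ) where

  private
    Rrev : Seq n → Coloring n
    Rrev [] = makeEquitable G π₀ π₀
    Rrev (v ∷ r) = makeEquitable G (ind (Rrev r) v) [ ⁅ v ⁆ ]

  Rbar : Seq n → Coloring n
  Rbar ν = Rrev (reverse ν)

  firstNonSingleton : Coloring n → Subset n
  firstNonSingleton [] = ∅
  firstNonSingleton (X ∷ π) = if 2 ≤ᵇ ∣ X ∣ then X else firstNonSingleton π

  Tbar : Seq n → Subset n
  Tbar ν = firstNonSingleton (Rbar ν)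

  phi : Seq n → List H
  phi ν = map (λ p → hash G (Rbar p)) (drop 1 (inits ν))

  _<φ_ : List H → List H → Set
  _<φ_ = Lex-< _≡_ _<H_

  data Node : Seq n → Set where
    root  : Node []
    child : ∀ {ν} → Node ν → (w : Fin n) → w ∈ Tbar ν → Node (ν ∷ʳ w)

  Leaf : Seq n → Set
  Leaf ν = Node ν × Discrete (Rbar ν)

  Gν : Seq n → Graph n
  Gν ν = graphBy (Rbar ν) G

  MaximalLeaf : Seq n → Set
  MaximalLeaf ν = Leaf ν × (∀ ν' → Leaf ν' → ¬ (phi ν <φ phi ν'))

  CanonicalLeaf : Seq n → Set
  CanonicalLeaf ν = MaximalLeaf ν
    × (∀ ν' → MaximalLeaf ν' → ¬ (Gν ν <G Gν ν'))
    × (∀ ν' → MaximalLeaf ν' → Gν ν' ≡ Gν ν → ¬ (ν' <lex ν))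

  IsCanonicalForm : Graph n → Coloring n → Set
  IsCanonicalForm G' π' = ∃ λ ν → CanonicalLeaf ν
    × (G' ≡ graphBy (Rbar ν) G) × (π' ≡ colBy (Rbar ν) π₀)

  -- the proof system: Derivable F  iff  some proof derives F
  data Derivable : Fact n → Set where
    coloringAxiom : Derivable (R⪯ [] π₀)
    individualize : ∀ {ν π} → Derivable (R≡ ν π) → (v : Fin n)
      → Derivable (R⪯ (ν ∷ʳ v) (ind π v))
    splitColoring : ∀ {ν π} → Derivable (R⪯ ν π) → (i : Fin (length π))
      → split G π i ≺ π
      → (∀ (j : Fin (length π)) → toℕ j < toℕ i → ¬ (split G π j ≺ π))
      → Derivable (R⪯ ν (split G π i))
    equitable : ∀ {ν π} → Derivable (R⪯ ν π)
      → (∀ (i : Fin (length π)) → split G π i ≡ π)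
      → Derivable (R≡ ν π)
    targetCell : ∀ {ν π} → Derivable (R≡ ν π) → (i : Fin (length π))
      → 1 < ∣ cell π i ∣
      → (∀ (j : Fin (length π)) → toℕ j < toℕ i → ∣ cell π j ∣ ≤ 1)
      → Derivable (T≡ ν (cell π i))
    invariantAxiom : ∀ ν → Derivable (φ≡ ν ν)
    invariantsEqual : ∀ {ν' ν'' v' v'' π₁ π₂} → Derivable (φ≡ ν' ν'')
      → Derivable (R≡ (ν' ∷ʳ v') π₁) → Derivable (R≡ (ν'' ∷ʳ v'') π₂)
      → hash G π₁ ≡ hash G π₂
      → Derivable (φ≡ (ν' ∷ʳ v') (ν'' ∷ʳ v''))
    invariantsEqualSym : ∀ {ν' ν''} → Derivable (φ≡ ν' ν'')
      → Derivable (φ≡ ν'' ν')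
    orbitsAxiom : ∀ ν (v : Fin n) → Derivable (orbit ⁅ v ⁆ ν)
    mergeOrbits : ∀ {ν Ω₁ Ω₂} → Derivable (orbit Ω₁ ν) → Derivable (orbit Ω₂ ν)
      → (σ : Permutation′ n) → IsAut G π₀ σ → map (σ ⟨$⟩ʳ_) ν ≡ ν
      → (w₁ w₂ : Fin n) → w₁ ∈ Ω₁ → w₂ ∈ Ω₂ → σ ⟨$⟩ʳ w₁ ≡ w₂
      → Derivable (orbit (Ω₁ ∪ Ω₂) ν)
    pruneInvariant : ∀ {ν' ν'' v' v'' π₁ π₂} → Derivable (φ≡ ν' ν'')
      → Derivable (R≡ (ν' ∷ʳ v') π₁) → Derivable (R≡ (ν'' ∷ʳ v'') π₂)
      → hash G π₂ <H hash G π₁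
      → Derivable (pruned (ν'' ∷ʳ v''))
    pruneLeaf : ∀ {ν' ν'' π₁ π₂} → Derivable (R≡ ν' π₁) → Derivable (R≡ ν'' π₂)
      → Derivable (φ≡ ν' ν'')
      → Discrete π₂ → (¬ Discrete π₁ ⊎ (graphBy π₂ G <G graphBy π₁ G))
      → Derivable (pruned ν'')
    pruneAutomorphism : ∀ ν' ν'' → ν' <lex ν''
      → (σ : Permutation′ n) → IsAut G π₀ σ → map (σ ⟨$⟩ʳ_) ν' ≡ ν''
      → Derivable (pruned ν'')
    pruneOrbits : ∀ {ν Ω} → Derivable (orbit Ω ν) → (w₁ w₂ : Fin n)
      → w₂ ∈ Ω → w₁ ∈ Ω → w₁ <V w₂
      → Derivable (pruned (ν ∷ʳ w₂))
    pruneParent : ∀ {ν W} → Derivable (T≡ ν W)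
      → (∀ w → w ∈ W → Derivable (pruned (ν ∷ʳ w)))
      → Derivable (pruned ν)
    pathAxiom : Derivable (onPath [])
    extendPath : ∀ {ν W} → Derivable (onPath ν) → Derivable (T≡ ν W) → (w : Fin n)
      → (∀ w' → w' ∈ W → w' ≢ w → Derivable (pruned (ν ∷ʳ w')))
      → Derivable (onPath (ν ∷ʳ w))
    canonicalLeaf : ∀ {ν π} → Derivable (onPath ν) → Derivable (R≡ ν π)
      → Discrete π
      → Derivable (C≡ (graphBy π G) (colBy π π₀))

{-# OPTIONS --safe #-}

-- make_equitable and the proof system split cells in the same order.  For any two
-- vertices in a common cell, the first cell in which they have different numbers
-- of neighbours always lies in the work list: of the fragments of a cell only the
-- last one may be missing there, and its counts are differences of counts for the
-- whole cell and for the earlier fragments.  Hence the first cell that splits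
-- anything is the first such cell of the work list, and the value of R̄(ν) is derivable.
--
-- Let ν⋆ be the canonical leaf.  A node that leaves the path to ν⋆ is pruned by
-- comparing it with the prefix of ν⋆ of the same length.  A larger hash would
-- contradict maximality and a smaller one prunes it; with equal hashes one descends
-- to its children.  A leaf reached in this way is pruned by PruneLeaf, unless its
-- graph is that of ν⋆.  In that case the permutation σ matching the two discrete
-- colorings is an automorphism, and it maps ν⋆ to the leaf: refinement commutes with
-- σ, and every individualized vertex is determined by the final coloring, where its
-- position is the number of singletons in front of its target cell.

module Submission where

open import Defs
open import Level using (0ℓ)
open import Data.Bool using (Bool; true; false; _∧_; not; T; if_then_else_)
open import Data.Bool.ListAction using (or)
import Data.Bool.Properties as Bool
open import Data.Nat using (ℕ; zero; suc; _+_; _*_; _⊔_; _≤_; _<_; _≡ᵇ_; _≤ᵇ_; _<ᵇ_; z≤n; s≤s)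
open import Data.Nat.Properties
open import Data.Fin using (Fin; zero; suc; toℕ; fromℕ<)
open import Data.Fin.Permutation using (Permutation′; permutation; _⟨$⟩ʳ_; _⟨$⟩ˡ_; inverseˡ; inverseʳ)
import Data.Fin.Properties as Fin
open import Data.Fin.Subset using (Subset; ∣_∣; ⁅_⁆; _─_) renaming (⊥ to ∅)
import Data.Fin.Subset.Properties as Subset
open import Data.Vec using ([]; _∷_; lookup)
import Data.Vec as Vec
open import Data.Vec.Properties using ([]=⇒lookup; lookup⇒[]=; lookup∘tabulate; tabulate∘lookup; tabulate-cong)
import Data.Vec.Properties as Vec
open import Data.List using (List; []; _∷_; [_]; _++_; _∷ʳ_; map; filter; length; tabulate; allFin; upTo; concatMap; inits; drop)
import Data.List as List
open import Data.List.Properties using (length-++; length-filter; length-tabulate; length-map; map-++; map-tabulate; map-cong; map-∘; map-injective; ++-assoc; ++-identityʳ; ∷ʳ-++; ∷ʳ-injective; upTo-∷ʳ)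
import Data.List.Properties as List
open import Data.List.Membership.Propositional using (_∈_; _∉_)
open import Data.List.Membership.Propositional.Properties using (∈-++⁺ˡ; ∈-++⁺ʳ; ∈-++⁻; ∈-lookup)
open import Data.List.Relation.Binary.Lex.Core using (Lex-<; halt; this; next)
import Data.List.Relation.Binary.Lex.Strict as Lex
open import Data.List.Relation.Binary.Pointwise using (Pointwise-≡⇒≡)
open import Data.List.Relation.Unary.All as All using (All; []; _∷_)
import Data.List.Relation.Unary.All.Properties as All
open import Data.List.Relation.Unary.Any using (Any; here; there)
open import Data.List.Reverse using (Reverse; reverseView; []; _∶_∶ʳ_)
open import Data.Maybe using (Maybe; just; nothing)
import Data.Maybe as Maybe
open import Data.Product using (∃; ∃₂; _×_; _,_; proj₁; proj₂)
open import Data.Sum using (_⊎_; inj₁; inj₂)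
open import Function using (_∘_; id; Equivalence)
open import Function.Definitions using (Injective)
open import Relation.Nullary using (¬_; Dec; yes; no; contradiction)
open import Relation.Binary.Core using (Rel)
open import Relation.Binary.Definitions using (tri<; tri≈; tri>)
open import Relation.Binary.Structures using (IsStrictTotalOrder)
open import Relation.Binary.PropositionalEquality hiding ([_])
open import Algebra.Properties.CommutativeMonoid.Sum +-0-commutativeMonoid using (sum; sum-cong-≗; ∑-distrib-+; sum-permute; sum-replicate-zero)

private variable
  n : ℕ

-- Counting vertices by indicator sums

χ : Bool → ℕ
χ true  = 1
χ false = 0

χ-∧ : ∀ a b → χ (a ∧ b) ≡ χ a * χ b
χ-∧ true  b = sym (+-identityʳ (χ b))
χ-∧ false b = refl

weight : (Fin n → ℕ) → Subset n → ℕ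
weight a X = sum λ v → χ (lookup X v) * a v

size≡weight : (X : Subset n) → ∣ X ∣ ≡ weight (λ _ → 1) X
size≡weight []          = refl
size≡weight (true  ∷ X) = cong suc (size≡weight X)
size≡weight (false ∷ X) = size≡weight X

length-filter-tabulate : ∀ {m} (b : Fin n → Bool) (f : Fin m → Fin n) →
  length (filter (λ u → b u Bool.≟ true) (tabulate f)) ≡ sum (χ ∘ b ∘ f)
length-filter-tabulate {m = zero}  b f = refl
length-filter-tabulate {m = suc m} b f with b (f zero)
... | true  = cong suc (length-filter-tabulate b (f ∘ suc))
... | false = length-filter-tabulate b (f ∘ suc)

nbrs≡weight : (G : Graph n) (W : Subset n) (x : Fin n) →
  nbrs G W x ≡ weight (χ ∘ adj G x) W
nbrs≡weight G W x = trans
  (length-filter-tabulate (λ u → lookup W u ∧ adj G x u) id)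
  (sum-cong-≗ λ u → χ-∧ (lookup W u) (adj G x u))

nbrs≤n : (G : Graph n) (W : Subset n) (x : Fin n) → nbrs G W x ≤ n
nbrs≤n {n} G W x = ≤-trans
  (length-filter (λ u → (lookup W u ∧ adj G x u) Bool.≟ true) (allFin n))
  (≤-reflexive (length-tabulate id))

-- Phrased by `lookup` instead of the membership relation of `Nonempty`, because the arguments below
-- branch on the Boolean `lookup X v`.
record Inhabited (X : Subset n) : Set where
  constructor _,_
  field
    witness   : Fin n
    inside    : lookup X witness ≡ true

sum-≥ : (f : Fin n → ℕ) (i : Fin n) → f i ≤ sum f
sum-≥ f zero    = m≤m+n _ _
sum-≥ f (suc i) = ≤-trans (sum-≥ (f ∘ suc) i) (m≤n+m _ _)

Inhabited⇒size : ∀ (X : Subset n) → Inhabited X → 1 ≤ ∣ X ∣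
Inhabited⇒size X (v , p) = subst (1 ≤_) (sym (size≡weight X))
  (≤-trans (≤-reflexive (cong (λ b → χ b * 1) (sym p))) (sum-≥ (λ v → χ (lookup X v) * 1) v))

size⇒Inhabited : ∀ (X : Subset n) → 1 ≤ ∣ X ∣ → Inhabited X
size⇒Inhabited (true  ∷ X) p = zero , refl
size⇒Inhabited (false ∷ X) p with size⇒Inhabited X p
... | v , q = suc v , q

size≤1⇒unique : ∀ (X : Subset n) → ∣ X ∣ ≤ 1 → ∀ {u v} →
  lookup X u ≡ true → lookup X v ≡ true → u ≡ v
size≤1⇒unique (_     ∷ X) s {zero}  {zero}  p q = refl
size≤1⇒unique (true  ∷ X) s {zero}  {suc v} p q =
  contradiction (Inhabited⇒size X (v , q)) (<⇒≱ s)
size≤1⇒unique (true  ∷ X) s {suc u} {_}     p q =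
  contradiction (Inhabited⇒size X (u , p)) (<⇒≱ s)
size≤1⇒unique (false ∷ X) s {suc u} {suc v} p q = cong suc (size≤1⇒unique X s p q)

-- A form of `cellsContaining` that is a sum of indicators, hence additive under `++` and usable as
-- a coefficient in sums over vertices.
occ : Coloring n → Fin n → ℕ
occ []      v = 0
occ (c ∷ π) v = χ (lookup c v) + occ π v

cellsContaining≡occ : (π : Coloring n) (v : Fin n) → cellsContaining π v ≡ occ π v
cellsContaining≡occ []      v = refl
cellsContaining≡occ (c ∷ π) v with lookup c v
... | true  = cong suc (cellsContaining≡occ π v)
... | false = cellsContaining≡occ π v

occ-++ : (π ρ : Coloring n) (v : Fin n) → occ (π ++ ρ) v ≡ occ π v + occ ρ v
occ-++ []      ρ v = refl
occ-++ (c ∷ π) ρ v =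
  trans (cong (χ (lookup c v) +_) (occ-++ π ρ v)) (sym (+-assoc (χ (lookup c v)) _ _))

occ-∈ : ∀ {π : Coloring n} {X v} → X ∈ π → lookup X v ≡ true → 1 ≤ occ π v
occ-∈ {v = v} (here refl) q rewrite q = s≤s z≤n
occ-∈ {π = Y ∷ π} {v = v} (there p) q = ≤-trans (occ-∈ p q) (m≤n+m _ (χ (lookup Y v)))

occ⇒∈ : ∀ (π : Coloring n) v → 1 ≤ occ π v → ∃ λ X → X ∈ π × lookup X v ≡ true
occ⇒∈ (X ∷ π) v p with lookup X v in eq
... | true  = X , here refl , eq
... | false = let Y , q , r = occ⇒∈ π v p in Y , there q , r

total : (Subset n → ℕ) → Coloring n → ℕ
total f []      = 0
total f (X ∷ π) = f X + total f π

total-++ : (f : Subset n → ℕ) (π ρ : Coloring n) → total f (π ++ ρ) ≡ total f π + total f ρ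
total-++ f []      ρ = refl
total-++ f (X ∷ π) ρ = trans (cong (f X +_) (total-++ f π ρ)) (sym (+-assoc (f X) _ _))

total-cong : ∀ {f g : Subset n → ℕ} {π} → All (λ X → f X ≡ g X) π → total f π ≡ total g π
total-cong []       = refl
total-cong (p ∷ ps) = cong₂ _+_ p (total-cong ps)

-- Double counting: both sides add up `a v` over all pairs of a cell and a vertex `v` in it.
total-weight : (a : Fin n → ℕ) (π : Coloring n) → total (weight a) π ≡ sum (λ v → occ π v * a v)
total-weight {n} a []  = sym (sum-replicate-zero n)
total-weight a (X ∷ π) = begin
  weight a X + total (weight a) π
    ≡⟨ cong (weight a X +_) (total-weight a π) ⟩
  weight a X + sum (λ v → occ π v * a v)
    ≡⟨ ∑-distrib-+ (λ v → χ (lookup X v) * a v) (λ v → occ π v * a v) ⟨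
  sum (λ v → χ (lookup X v) * a v + occ π v * a v)
    ≡⟨ sum-cong-≗ (λ v → *-distribʳ-+ (a v) (χ (lookup X v)) (occ π v)) ⟨
  sum (λ v → occ (X ∷ π) v * a v) ∎
  where open ≡-Reasoning

length≤total : ∀ {π : Coloring n} → All Inhabited π → length π ≤ total ∣_∣ π
length≤total []       = z≤n
length≤total (p ∷ ps) = +-mono-≤ (Inhabited⇒size _ p) (length≤total ps)

-- Partitions of a cell and refinement in place

record Parts (X : Subset n) (Fs : Coloring n) : Set where
  constructor parts
  field
    -- One equation says that the parts stay inside `X`, exhaust it and do not meet each other.
    covers    : ∀ v → occ Fs v ≡ χ (lookup X v)
    inhabited : All Inhabited Fs
open Parts public

module _ {X : Subset n} {Fs : Coloring n} (P : Parts X Fs) where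

  Parts-weight : (a : Fin n → ℕ) → total (weight a) Fs ≡ weight a X
  Parts-weight a = trans (total-weight a Fs) (sum-cong-≗ λ v → cong (_* a v) (covers P v))

  Parts-nbrs : (G : Graph n) (x : Fin n) → total (λ W → nbrs G W x) Fs ≡ nbrs G X x
  Parts-nbrs G x = trans (total-cong (All.universal (λ W → nbrs≡weight G W x) Fs))
    (trans (Parts-weight (χ ∘ adj G x)) (sym (nbrs≡weight G X x)))

  Parts-size : total ∣_∣ Fs ≡ ∣ X ∣
  Parts-size = trans (total-cong (All.universal size≡weight Fs))
    (trans (Parts-weight (λ _ → 1)) (sym (size≡weight X)))

  Parts-⊆ : ∀ {F v} → F ∈ Fs → lookup F v ≡ true → lookup X v ≡ true
  Parts-⊆ {v = v} p q with lookup X v | covers P v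
  ... | true  | _ = refl
  ... | false | e = contradiction (occ-∈ p q) (<⇒≱ (≤-reflexive (cong suc e)))

  Parts-length≥1 : Inhabited X → 1 ≤ length Fs
  Parts-length≥1 (v , p) = nonempty Fs (≤-reflexive (trans (cong χ (sym p)) (sym (covers P v))))
    where
    nonempty : ∀ (π : Coloring n) → 1 ≤ occ π v → 1 ≤ length π
    nonempty (_ ∷ _) _ = s≤s z≤n

  Parts-length≤size : length Fs ≤ ∣ X ∣
  Parts-length≤size = ≤-trans (length≤total (inhabited P)) (≤-reflexive Parts-size)

Parts-trivial : {X : Subset n} → Inhabited X → Parts X [ X ]
Parts-trivial p = parts (λ v → +-identityʳ _) (p ∷ [])

-- Weaker than being a partition of all vertices, so that it passes to the tail of a coloring and
-- supports induction over the cells.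
record Disjoint (π : Coloring n) : Set where
  constructor disjoint
  field
    once : ∀ v → occ π v ≤ 1
    nonempty : All Inhabited π
open Disjoint public

Disjoint-tail : ∀ {X} {π : Coloring n} → Disjoint (X ∷ π) → Disjoint π
Disjoint-tail {X = X} (disjoint o (_ ∷ i)) =
  disjoint (λ v → ≤-trans (m≤n+m _ (χ (lookup X v))) (o v)) i

Disjoint-head : ∀ {X} {π : Coloring n} → Disjoint (X ∷ π) → ∀ {Y v} → Y ∈ π →
  lookup X v ≡ true → lookup Y v ≢ true
Disjoint-head {X = X} D {v = v} p q r =
  <⇒≱ (s≤s (occ-∈ p r)) (subst (λ b → χ b + _ ≤ 1) q (once D v))

-- Every cell is replaced, where it stands, by a list of its parts. Splitting, individualization and
-- `makeEquitable` all act in this way.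
data Refines {n} : Coloring n → Coloring n → Set where
  []  : Refines [] []
  _∷_ : ∀ {X Fs π ρ} → Parts X Fs → Refines π ρ → Refines (X ∷ π) (Fs ++ ρ)

Refines-occ : ∀ {π ρ : Coloring n} → Refines π ρ → ∀ v → occ ρ v ≡ occ π v
Refines-occ []                    v = refl
Refines-occ (_∷_ {Fs = Fs} P r) v =
  trans (occ-++ Fs _ v) (cong₂ _+_ (covers P v) (Refines-occ r v))

Refines-inhabited : ∀ {π ρ : Coloring n} → Refines π ρ → All Inhabited ρ
Refines-inhabited []      = []
Refines-inhabited (P ∷ r) = All.++⁺ (inhabited P) (Refines-inhabited r)

Refines-Disjoint : ∀ {π ρ : Coloring n} → Refines π ρ → Disjoint π → Disjoint ρ
Refines-Disjoint r D = disjoint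
  (λ v → subst (_≤ 1) (sym (Refines-occ r v)) (once D v)) (Refines-inhabited r)

Refines-refl : ∀ {π : Coloring n} → All Inhabited π → Refines π π
Refines-refl []       = []
Refines-refl (p ∷ ps) = Parts-trivial p ∷ Refines-refl ps

Refines-++⁻ : ∀ (π₁ : Coloring n) {π₂ ρ} → Refines (π₁ ++ π₂) ρ →
  ∃₂ λ ρ₁ ρ₂ → ρ ≡ ρ₁ ++ ρ₂ × Refines π₁ ρ₁ × Refines π₂ ρ₂
Refines-++⁻ []       r = [] , _ , refl , [] , r
Refines-++⁻ (X ∷ π₁) (_∷_ {Fs = Fs} P r) with Refines-++⁻ π₁ r
... | ρ₁ , ρ₂ , refl , r₁ , r₂ = Fs ++ ρ₁ , ρ₂ , sym (++-assoc Fs ρ₁ ρ₂) , P ∷ r₁ , r₂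

Refines-trans : ∀ {π ρ τ : Coloring n} → Refines π ρ → Refines ρ τ → Refines π τ
Refines-trans []                   r = r
Refines-trans (_∷_ {Fs = Fs} P p) r with Refines-++⁻ Fs r
... | τ₁ , τ₂ , refl , r₁ , r₂ =
  parts (λ v → trans (Refines-occ r₁ v) (covers P v)) (Refines-inhabited r₁) ∷ Refines-trans p r₂

Refines-concatMap : (f : Subset n → List (Subset n)) → (∀ {X} → Inhabited X → Parts X (f X)) →
  ∀ {π} → All Inhabited π → Refines π (concatMap f π)
Refines-concatMap f P []       = []
Refines-concatMap f P (i ∷ is) = P i ∷ Refines-concatMap f P is

Refines-length : ∀ {π ρ : Coloring n} → All Inhabited π → Refines π ρ → length π ≤ length ρ
Refines-length []       []                   = z≤n
Refines-length (i ∷ is) (_∷_ {Fs = Fs} P r) = subst (_ ≤_) (sym (length-++ Fs))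
  (+-mono-≤ (Parts-length≥1 P i) (Refines-length is r))

col-++ˡ : ∀ (π : Coloring n) {ρ v} → 1 ≤ occ π v →
  col (π ++ ρ) v ≡ col π v × col π v < length π
col-++ˡ (X ∷ π) {v = v} p with lookup X v
... | true  = refl , s≤s z≤n
... | false = let e , l = col-++ˡ π p in cong suc e , s≤s l

col-++ʳ : ∀ (π : Coloring n) {ρ v} → occ π v ≡ 0 → col (π ++ ρ) v ≡ length π + col ρ v
col-++ʳ []      p = refl
col-++ʳ (X ∷ π) {v = v} p with lookup X v
... | false = cong suc (col-++ʳ π p)

module _ {X : Subset n} {Fs ρ : Coloring n} (P : Parts X Fs) {v : Fin n} where

  col-Parts-inside : lookup X v ≡ true → col (Fs ++ ρ) v < length Fs
  col-Parts-inside p =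
    let e , l = col-++ˡ Fs (≤-reflexive (trans (cong χ (sym p)) (sym (covers P v))))
    in ≤-trans (s≤s (≤-reflexive e)) l

  col-Parts-outside : lookup X v ≡ false → col (Fs ++ ρ) v ≡ length Fs + col ρ v
  col-Parts-outside p = col-++ʳ Fs (trans (covers P v) (cong χ p))

-- The vertices of the first cell fill the positions below `length Fs`; all others come later,
-- shifted by the same amount, and are handled by induction.
Refines⇒⪯ : ∀ {π ρ : Coloring n} → Refines π ρ → ρ ⪯ π
Refines⇒⪯ []                                     u v ()
Refines⇒⪯ (_∷_ {X = X} {Fs = Fs} {ρ = ρ} P r) u v p
  with lookup X u in eu | lookup X v in ev
... | true  | false = subst (col (Fs ++ ρ) u <_) (sym (col-Parts-outside P ev))
  (≤-trans (col-Parts-inside P eu) (m≤m+n _ _))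
... | false | false = subst₂ _<_ (sym (col-Parts-outside P eu)) (sym (col-Parts-outside P ev))
  (+-monoʳ-< (length Fs) (Refines⇒⪯ r u v (≤-pred p)))

-- Boolean tests and extensionality of subsets

T⁺ : ∀ {b} → b ≡ true → T b
T⁺ refl = _

≡ᵇ-true : ∀ m k → (m ≡ᵇ k) ≡ true → m ≡ k
≡ᵇ-true m k p = ≡ᵇ⇒≡ m k (T⁺ p)

≡ᵇ-refl : ∀ m → (m ≡ᵇ m) ≡ true
≡ᵇ-refl zero    = refl
≡ᵇ-refl (suc m) = ≡ᵇ-refl m

∧-true : ∀ {a b} → a ∧ b ≡ true → a ≡ true × b ≡ true
∧-true {true} p = refl , p

Subset-ext : {X Y : Subset n} → (∀ v → lookup X v ≡ lookup Y v) → X ≡ Y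
Subset-ext {X = X} {Y} p =
  trans (sym (tabulate∘lookup X)) (trans (tabulate-cong p) (tabulate∘lookup Y))

χ-<ᵇ-suc : ∀ k m → χ (k <ᵇ m) + (χ (k ≡ᵇ m) + 0) ≡ χ (k <ᵇ suc m)
χ-<ᵇ-suc zero    zero    = refl
χ-<ᵇ-suc zero    (suc m) = refl
χ-<ᵇ-suc (suc k) zero    = refl
χ-<ᵇ-suc (suc k) (suc m) = χ-<ᵇ-suc k m

-- The fragments of a cell

nonempty? : (F : Subset n) → Dec ((1 ≤ᵇ ∣ F ∣) ≡ true)
nonempty? F = (1 ≤ᵇ ∣ F ∣) Bool.≟ true

Uniform : Graph n → Subset n → Subset n → Set
Uniform G W X = ∀ u v → lookup X u ≡ true → lookup X v ≡ true → nbrs G W u ≡ nbrs G W v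

size≤1⇒Uniform : (G : Graph n) (W X : Subset n) → ∣ X ∣ ≤ 1 → Uniform G W X
size≤1⇒Uniform G W X s u v p q = cong (nbrs G W) (size≤1⇒unique X s p q)

module _ (G : Graph n) (W X : Subset n) where

  lookup-fragment : ∀ k v → lookup (fragment G W X k) v ≡ lookup X v ∧ (nbrs G W v ≡ᵇ k)
  lookup-fragment k v = lookup∘tabulate _ v

  -- A vertex of `X` lies only in the fragment of its own count, so the first `m` fragments collect
  -- the vertices of count below `m`. The induction peels off the last index, where the counts equal
  -- to `m` join.
  occ-fragment-upTo : ∀ m v →
    occ (map (fragment G W X) (upTo m)) v ≡ χ (lookup X v ∧ (nbrs G W v <ᵇ m))
  occ-fragment-upTo zero    v = cong χ (sym (Bool.∧-zeroʳ (lookup X v)))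
  occ-fragment-upTo (suc m) v = begin
    occ (map (fragment G W X) (upTo (suc m))) v
      ≡⟨ cong (λ ks → occ (map (fragment G W X) ks) v) (upTo-∷ʳ m) ⟨
    occ (map (fragment G W X) (upTo m ∷ʳ m)) v
      ≡⟨ cong (λ Fs → occ Fs v) (map-++ (fragment G W X) (upTo m) [ m ]) ⟩
    occ (map (fragment G W X) (upTo m) ∷ʳ fragment G W X m) v
      ≡⟨ occ-++ (map (fragment G W X) (upTo m)) [ fragment G W X m ] v ⟩
    occ (map (fragment G W X) (upTo m)) v + (χ (lookup (fragment G W X m) v) + 0)
      ≡⟨ cong₂ (λ k b → k + (χ b + 0)) (occ-fragment-upTo m v) (lookup-fragment m v) ⟩
    χ (lookup X v ∧ (nbrs G W v <ᵇ m)) + (χ (lookup X v ∧ (nbrs G W v ≡ᵇ m)) + 0)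
      ≡⟨ absorb (lookup X v) ⟩
    χ (lookup X v ∧ (nbrs G W v <ᵇ suc m)) ∎
    where
    open ≡-Reasoning
    absorb : ∀ b → χ (b ∧ (nbrs G W v <ᵇ m)) + (χ (b ∧ (nbrs G W v ≡ᵇ m)) + 0)
                 ≡ χ (b ∧ (nbrs G W v <ᵇ suc m))
    absorb true  = χ-<ᵇ-suc (nbrs G W v) m
    absorb false = refl

  occ-filter-nonempty : ∀ (Fs : Coloring n) v →
    occ (filter nonempty? Fs) v ≡ occ Fs v
  occ-filter-nonempty []       v = refl
  occ-filter-nonempty (F ∷ Fs) v with 1 ≤ᵇ ∣ F ∣ in s
  ... | true  = cong (χ (lookup F v) +_) (occ-filter-nonempty Fs v)
  ... | false with lookup F v in p
  ...   | false = occ-filter-nonempty Fs v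
  ...   | true  = contradiction (≤⇒≤ᵇ (Inhabited⇒size F (v , p))) (subst (λ b → ¬ T b) (sym s) id)

  -- Counts are at most `n`, so the indices below `suc n` catch every vertex of `X`, and dropping
  -- empty fragments loses none.
  occ-fragments : ∀ v → occ (fragments G W X) v ≡ χ (lookup X v)
  occ-fragments v = trans (occ-filter-nonempty (map (fragment G W X) (upTo (suc n))) v)
    (trans (occ-fragment-upTo (suc n) v) (cong χ lemma))
    where
    lemma : lookup X v ∧ (nbrs G W v <ᵇ suc n) ≡ lookup X v
    lemma rewrite Bool.T-≡ .Equivalence.to (<⇒<ᵇ (s≤s (nbrs≤n G W v))) =
      Bool.∧-identityʳ (lookup X v)

-- The `Any` hypothesis keeps `extract` from reaching its default value `∅`, for which `P` might
-- fail.
extract-All : ∀ {P : Subset n → Set} {m Fs} → Any (λ F → ∣ F ∣ ≡ m) Fs → All P Fs →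
  All P (proj₁ (extract m Fs) ∷ʳ proj₂ (extract m Fs))
extract-All {m = m} {F ∷ Fs} a (p ∷ ps) with ∣ F ∣ ≡ᵇ m in eq
... | true  = All.∷ʳ⁺ ps p
extract-All {m = m} {F ∷ Fs} (here refl) (p ∷ ps) | false with trans (sym eq) (≡ᵇ-refl m)
... | ()
extract-All {m = m} {F ∷ Fs} (there a) (p ∷ ps) | false = p ∷ extract-All a ps

extract-occ : ∀ {m} {Fs : Coloring n} → Any (λ F → ∣ F ∣ ≡ m) Fs → ∀ v →
  occ (proj₁ (extract m Fs) ∷ʳ proj₂ (extract m Fs)) v ≡ occ Fs v
extract-occ {m = m} {F ∷ Fs} a v with ∣ F ∣ ≡ᵇ m in eq
... | true  = trans (occ-++ Fs [ F ] v) (trans (cong (occ Fs v +_) (+-identityʳ _)) (+-comm (occ Fs v) _))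
extract-occ {m = m} {F ∷ Fs} (here refl) v | false with trans (sym eq) (≡ᵇ-refl m)
... | ()
extract-occ {m = m} {F ∷ Fs} (there a) v | false = cong (χ (lookup F v) +_) (extract-occ a v)

maxSize-attained : ∀ (F : Subset n) Fs → Any (λ F′ → ∣ F′ ∣ ≡ maxSize (F ∷ Fs)) (F ∷ Fs)
maxSize-attained F [] = here (sym (⊔-identityʳ ∣ F ∣))
maxSize-attained F (F′ ∷ Fs) with ⊔-sel ∣ F ∣ (maxSize (F′ ∷ Fs))
... | inj₁ eq = here (sym eq)
... | inj₂ eq = there (subst (λ m → Any (λ H → ∣ H ∣ ≡ m) (F′ ∷ Fs)) (sym eq) (maxSize-attained F′ Fs))

module _ (G : Graph n) (W : Subset n) {X : Subset n} (X≠∅ : Inhabited X) where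

  -- The fragments cover the witness of `X≠∅`, so there is at least one and the maximal size is
  -- attained.
  fragments-maxSize : Any (λ F → ∣ F ∣ ≡ maxSize (fragments G W X)) (fragments G W X)
  fragments-maxSize with fragments G W X | occ-fragments G W X (Inhabited.witness X≠∅)
  ... | []     | e = contradiction (trans e (cong χ (Inhabited.inside X≠∅))) λ ()
  ... | F ∷ Fs | _ = maxSize-attained F Fs

  refineCell-All : ∀ {P : Subset n → Set} → All P (fragments G W X) → All P (refineCell G W X)
  refineCell-All = extract-All fragments-maxSize

  refineCell-Parts : Parts X (refineCell G W X)
  refineCell-Parts = parts
    (λ v → trans (extract-occ fragments-maxSize v) (occ-fragments G W X v))
    (refineCell-All (All.map (λ {F} s → size⇒Inhabited F (≤ᵇ⇒≤ 1 _ (T⁺ s)))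
      (All.all-filter nonempty? (map (fragment G W X) (upTo (suc n))))))

  refineCell-fragment : All (λ F → ∃ λ k → F ≡ fragment G W X k) (refineCell G W X)
  refineCell-fragment = refineCell-All (All.filter⁺ nonempty?
    (All.map⁺ (All.universal (λ k → k , refl) (upTo (suc n)))))

  refineCell-Uniform : All (Uniform G W) (refineCell G W X)
  refineCell-Uniform = All.map uniform refineCell-fragment
    where
    uniform : ∀ {F} → (∃ λ k → F ≡ fragment G W X k) → Uniform G W F
    uniform (k , refl) u v p q = trans (count u p) (sym (count v q))
      where
      count : ∀ x → lookup (fragment G W X k) x ≡ true → nbrs G W x ≡ k
      count x r = ≡ᵇ-true _ _ (proj₂ (∧-true {lookup X x} (trans (sym (lookup-fragment G W X k x)) r)))

  -- With a single count on `X`, every nonempty fragment is all of `X`. The witness lies in exactly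
  -- one fragment, so there are no two of them.
  refineCell-trivial : Uniform G W X → refineCell G W X ≡ [ X ]
  refineCell-trivial U = only (refineCell G W X)
      (All.zipWith (λ (f , i) → whole f i) (refineCell-fragment , inhabited refineCell-Parts))
      (trans (covers refineCell-Parts x₀) (cong χ x₀∈X))
    where
    x₀ = Inhabited.witness X≠∅
    x₀∈X = Inhabited.inside X≠∅
    whole : ∀ {F} → (∃ λ k → F ≡ fragment G W X k) → Inhabited F → F ≡ X
    whole (k , refl) (v , p) = Subset-ext same
      where
      v∈X×nbrs : lookup X v ≡ true × (nbrs G W v ≡ᵇ k) ≡ true
      v∈X×nbrs = ∧-true (trans (sym (lookup-fragment G W X k v)) p)
      same : ∀ u → lookup (fragment G W X k) u ≡ lookup X u
      same u with lookup X u in q | lookup-fragment G W X k u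
      ... | false | e = e
      ... | true  | e = trans e (trans (cong (_≡ᵇ k) (U u v q (proj₁ v∈X×nbrs))) (proj₂ v∈X×nbrs))
    only : ∀ L → All (_≡ X) L → occ L x₀ ≡ 1 → L ≡ [ X ]
    only (_ ∷ [])    (refl ∷ [])       _ = refl
    only (_ ∷ _ ∷ L) (refl ∷ refl ∷ _) e =
      contradiction (trans (sym e) (cong (λ b → χ b + (χ b + occ L x₀)) x₀∈X)) λ ()

-- Splitting a coloring by its cells until nothing changes

splitBy : Graph n → Subset n → Coloring n → Coloring n
splitBy G W = concatMap (refineCell G W)

splitBy-trivial : ∀ (G : Graph n) W {π} → All Inhabited π → All (Uniform G W) π → splitBy G W π ≡ π
splitBy-trivial G W []       []       = refl
splitBy-trivial G W (i ∷ is) (u ∷ us) =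
  cong₂ _++_ (refineCell-trivial G W i u) (splitBy-trivial G W is us)

splitBy-Uniform : ∀ (G : Graph n) W {π} → All Inhabited π → All (Uniform G W) (splitBy G W π)
splitBy-Uniform G W []       = []
splitBy-Uniform G W (i ∷ is) = All.++⁺ (refineCell-Uniform G W i) (splitBy-Uniform G W is)

splitBy-Refines : ∀ (G : Graph n) W {π} → All Inhabited π → Refines π (splitBy G W π)
splitBy-Refines G W = Refines-concatMap (refineCell G W) (refineCell-Parts G W)

Equitable : Graph n → Coloring n → Set
Equitable G π = All (λ W → All (Uniform G W) π) π

Equitable-Discrete : ∀ (G : Graph n) {π} → Discrete π → Equitable G π
Equitable-Discrete G d = All.universal
  (λ W → All.map (λ {X} s → size≤1⇒Uniform G W X (≤-reflexive s)) d) _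

_≟ᶜ_ : (π ρ : Coloring n) → Dec (π ≡ ρ)
_≟ᶜ_ = List.≡-dec (Vec.≡-dec Bool._≟_)

-- The cells to be tried and the coloring to be split are separate arguments, so that induction can
-- shorten the first alone. Testing for inequality is enough for `≺`, since a split always refines.
findSplit : Graph n → Coloring n → Coloring n → Maybe (Subset n)
findSplit G []       π = nothing
findSplit G (W ∷ Ws) π with splitBy G W π ≟ᶜ π
... | yes _ = findSplit G Ws π
... | no  _ = just W

-- The strategy that SplitColoring imposes: always split by the first cell that
-- splits anything.
data Closure (G : Graph n) : Coloring n → Coloring n → Set where
  stop : ∀ {π} → findSplit G π π ≡ nothing → Closure G π π
  step : ∀ {π ρ W} → findSplit G π π ≡ just W → Closure G (splitBy G W π) ρ → Closure G π ρ

-- This turns equivariance of `Closure` into equality of `Rbar` values, without following the work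
-- list under a permutation.
Closure-deterministic : ∀ {G : Graph n} {π ρ ρ′} → Closure G π ρ → Closure G π ρ′ → ρ ≡ ρ′
Closure-deterministic (stop _)   (stop _)   = refl
Closure-deterministic (stop p)   (step q _) = contradiction (trans (sym p) q) λ ()
Closure-deterministic (step p _) (stop q)   = contradiction (trans (sym p) q) λ ()
Closure-deterministic (step p c) (step q d) with trans (sym p) q
... | refl = Closure-deterministic c d

Closure-Refines : ∀ {G : Graph n} {π ρ} → All Inhabited π → Closure G π ρ → Refines π ρ
Closure-Refines is (stop _)           = Refines-refl is
Closure-Refines {G = G} is (step {W = W} _ c) =
  let r = splitBy-Refines G W is
  in Refines-trans r (Closure-Refines (Refines-inhabited r) c)

findSplit-nothing⁺ : ∀ (G : Graph n) {Ws π} →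
  All (λ W → splitBy G W π ≡ π) Ws → findSplit G Ws π ≡ nothing
findSplit-nothing⁺ G []               = refl
findSplit-nothing⁺ G {W ∷ _} {π} (p ∷ ps) with splitBy G W π ≟ᶜ π
... | yes _ = findSplit-nothing⁺ G ps
... | no ¬p = contradiction p ¬p

findSplit-nothing⁻ : ∀ (G : Graph n) Ws {π} →
  findSplit G Ws π ≡ nothing → All (λ W → splitBy G W π ≡ π) Ws
findSplit-nothing⁻ G []           e = []
findSplit-nothing⁻ G (W ∷ Ws) {π} e with splitBy G W π ≟ᶜ π
... | yes p = p ∷ findSplit-nothing⁻ G Ws e

findSplit-just⁺ : ∀ (G : Graph n) {Ws W Vs π} → All (λ W → splitBy G W π ≡ π) Ws →
  splitBy G W π ≢ π → findSplit G (Ws ++ W ∷ Vs) π ≡ just W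
findSplit-just⁺ G {[]} {W} {_} {π} [] ¬p with splitBy G W π ≟ᶜ π
... | yes p = contradiction p ¬p
... | no _  = refl
findSplit-just⁺ G {W ∷ Ws} {π = π} (p ∷ ps) ¬q with splitBy G W π ≟ᶜ π
... | yes _ = findSplit-just⁺ G ps ¬q
... | no ¬p = contradiction p ¬p

findSplit-just⁻ : ∀ (G : Graph n) Ws {π W} → findSplit G Ws π ≡ just W →
  ∃ λ i → List.lookup Ws i ≡ W × splitBy G W π ≢ π ×
    (∀ j → toℕ j < toℕ i → splitBy G (List.lookup Ws j) π ≡ π)
findSplit-just⁻ G (W ∷ Ws) {π} e with splitBy G W π ≟ᶜ π
findSplit-just⁻ G (W ∷ Ws) {π} refl | no ¬p = zero , refl , ¬p , λ _ ()
findSplit-just⁻ G (W ∷ Ws) {π} e    | yes p =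
  let i , q , ¬r , minimal = findSplit-just⁻ G Ws e
  in suc i , q , ¬r , λ { zero _ → p ; (suc j) (s≤s l) → minimal j l }

-- Splitting by `W` always yields cells that are uniform for `W`, and at the end splitting by any
-- cell leaves the coloring as it is.
Closure-Equitable : ∀ {G : Graph n} {π ρ} → All Inhabited π → Closure G π ρ → Equitable G ρ
Closure-Equitable {G = G} {π} is (stop e) = All.map
  (λ {W} p → subst (All (Uniform G W)) p (splitBy-Uniform G W is)) (findSplit-nothing⁻ G π e)
Closure-Equitable {G = G} is (step {W = W} _ c) =
  Closure-Equitable (Refines-inhabited (splitBy-Refines G W is)) c

-- The work list of make_equitable

memS-∈ : ∀ {X : Subset n} α → memS X α ≡ true → X ∈ α
memS-∈ {X = X} (Y ∷ α) p with Vec.≡-dec Bool._≟_ X Y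
... | yes q = here q
... | no  _ = there (memS-∈ α p)

∈-memS : ∀ {X : Subset n} {α} → X ∈ α → memS X α ≡ true
∈-memS {X = X} {Y ∷ α} p with Vec.≡-dec Bool._≟_ X Y
∈-memS p         | yes _ = refl
∈-memS (here q)  | no ¬q = contradiction q ¬q
∈-memS (there p) | no _  = ∈-memS p

removeFirst-keeps : ∀ {W Y : Subset n} {α} → Y ∈ α → Y ≢ W → Y ∈ removeFirst W α
removeFirst-keeps {W = W} {α = Z ∷ α} p ¬q with Vec.≡-dec Bool._≟_ W Z
removeFirst-keeps (here refl) ¬q | yes refl = contradiction refl ¬q
removeFirst-keeps (there p)   ¬q | yes _    = p
removeFirst-keeps (here refl) ¬q | no _     = here refl
removeFirst-keeps (there p)   ¬q | no _     = there (removeFirst-keeps p ¬q)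

removeFirst-length : ∀ {W : Subset n} {α} → W ∈ α → suc (length (removeFirst W α)) ≡ length α
removeFirst-length {W = W} {Z ∷ α} p with Vec.≡-dec Bool._≟_ W Z
removeFirst-length p           | yes _ = refl
removeFirst-length (here q)    | no ¬q = contradiction q ¬q
removeFirst-length (there p)   | no _  = cong suc (removeFirst-length p)

replaceS-keeps : ∀ {X Y Z : Subset n} {α} → Y ∈ α → Y ≢ X → Y ∈ replaceS X Z α
replaceS-keeps {X = X} {Y} (here refl) ¬q with Vec.≡-dec Bool._≟_ Y X
... | yes q = contradiction q ¬q
... | no _  = here refl
replaceS-keeps (there p) ¬q = there (replaceS-keeps p ¬q)

replaceS-new : ∀ {X Z : Subset n} {α} → X ∈ α → Z ∈ replaceS X Z α
replaceS-new {X = X} (here refl) with Vec.≡-dec Bool._≟_ X X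
... | yes _ = here refl
... | no ¬q = contradiction refl ¬q
replaceS-new (there p) = there (replaceS-new p)

firstIn-just : ∀ (π : Coloring n) {α W} → firstIn π α ≡ just W →
  ∃₂ λ ps qs → π ≡ ps ++ W ∷ qs × All (_∉ α) ps × W ∈ α
firstIn-just (X ∷ π) {α} e with memS X α in m
firstIn-just (X ∷ π) {α} refl | true = [] , π , refl , [] , memS-∈ α m
... | false =
  let ps , qs , eq , ∉s , W∈ = firstIn-just π e
  in X ∷ ps , qs , cong (X ∷_) eq ,
     (λ p → contradiction (trans (sym m) (∈-memS p)) λ ()) ∷ ∉s , W∈

firstIn-nothing : ∀ (π : Coloring n) {α} → firstIn π α ≡ nothing → All (_∉ α) π
firstIn-nothing []          e = []
firstIn-nothing (X ∷ π) {α} e with memS X α in m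
... | false = (λ p → contradiction (trans (sym m) (∈-memS p)) λ ()) ∷ firstIn-nothing π e

-- The update of the work list that `refineAll` makes for a cell `X` and the result of shattering
-- it.
enqueue : Subset n → List (Subset n) × Subset n → List (Subset n) → List (Subset n)
enqueue X (Fs , L) α = (if memS X α then replaceS X L α else α) ++ Fs

enqueue-length : ∀ (X : Subset n) s α → length (enqueue X s α) ≡ length α + length (proj₁ s)
enqueue-length X (Fs , L) α with memS X α
... | true  = trans (length-++ (replaceS X L α)) (cong (_+ length Fs) (length-map _ α))
... | false = length-++ α

enqueue-keeps : ∀ {X Y : Subset n} s {α} → Y ∈ α → Y ≢ X → Y ∈ enqueue X s α
enqueue-keeps {X = X} (Fs , L) {α} p ¬q with memS X α
... | true  = ∈-++⁺ˡ (replaceS-keeps p ¬q)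
... | false = ∈-++⁺ˡ p

enqueue-last : ∀ {X : Subset n} s {α} → X ∈ α → proj₂ s ∈ enqueue X s α
enqueue-last {X = X} (Fs , L) {α} p rewrite ∈-memS p = ∈-++⁺ˡ (replaceS-new p)

enqueue-new : ∀ (X : Subset n) s α {F} → F ∈ proj₁ s → F ∈ enqueue X s α
enqueue-new X (Fs , L) α p = ∈-++⁺ʳ (if memS X α then replaceS X L α else α) p

module _ (G : Graph n) (W : Subset n) where

  -- The cells that `refineAll` skips have at most one vertex, and `refineCell` does not change
  -- those. The work list has no influence on the cells.
  refineAll-cells : ∀ {π} α → All Inhabited π → proj₁ (refineAll G W π α) ≡ splitBy G W π
  refineAll-cells α [] = refl
  refineAll-cells {X ∷ π} α (i ∷ is) with ∣ X ∣ ≤ᵇ 1 in s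
  ... | true  = cong₂ _++_
    (sym (refineCell-trivial G W i (size≤1⇒Uniform G W X (≤ᵇ⇒≤ _ 1 (T⁺ s))))) (refineAll-cells α is)
  ... | false = trans
    (cong (λ ρ → proj₁ (shatter G W X) ++ proj₂ (shatter G W X) ∷ ρ) (refineAll-cells _ is))
    (sym (++-assoc (proj₁ (shatter G W X)) _ _))

  -- The work list gains one entry for each new cell. The balance is written as a sum to avoid
  -- subtraction.
  refineAll-length : ∀ π α →
    length (proj₂ (refineAll G W π α)) + length π ≡ length α + length (proj₁ (refineAll G W π α))
  refineAll-length []      α = refl
  refineAll-length (X ∷ π) α with ∣ X ∣ ≤ᵇ 1
  ... | true  = trans (+-suc _ (length π))
    (trans (cong suc (refineAll-length π α)) (sym (+-suc (length α) _)))
  ... | false = begin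
    a + suc (length π)            ≡⟨ +-suc a (length π) ⟩
    suc (a + length π)            ≡⟨ cong suc (refineAll-length π (enqueue X s α)) ⟩
    suc (length (enqueue X s α) + r)  ≡⟨ cong (λ l → suc (l + r)) (enqueue-length X s α) ⟩
    suc (length α + f + r)        ≡⟨ cong suc (+-assoc (length α) f r) ⟩
    suc (length α + (f + r))      ≡⟨ +-suc (length α) (f + r) ⟨
    length α + suc (f + r)        ≡⟨ cong (length α +_) (+-suc f r) ⟨
    length α + (f + suc r)        ≡⟨ cong (length α +_) (length-++ (proj₁ s)) ⟨
    length α + length (proj₁ s ++ proj₂ s ∷ proj₁ (refineAll G W π (enqueue X s α))) ∎
    where
    open ≡-Reasoning
    s = shatter G W X
    a = length (proj₂ (refineAll G W π (enqueue X s α)))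
    r = length (proj₁ (refineAll G W π (enqueue X s α)))
    f = length (proj₁ s)

  -- Entries of the work list are overwritten only when they equal a cell that is still to be
  -- processed.
  refineAll-keeps : ∀ π {α Y} → Y ∈ α → Y ∉ π → Y ∈ proj₂ (refineAll G W π α)
  refineAll-keeps []      p ¬q = p
  refineAll-keeps (X ∷ π) p ¬q with ∣ X ∣ ≤ᵇ 1
  ... | true  = refineAll-keeps π p (¬q ∘ there)
  ... | false = refineAll-keeps π (enqueue-keeps (shatter G W X) p (¬q ∘ here)) (¬q ∘ there)

-- A part of `X` has a vertex, which lies in `X` and therefore in no later cell.
Parts-fresh : ∀ {X} {π Fs : Coloring n} {F} → Disjoint (X ∷ π) → Parts X Fs → F ∈ Fs → F ∉ π
Parts-fresh D P F∈Fs F∈π with All.lookup (inhabited P) F∈Fs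
... | x , p = Disjoint-head D F∈π (Parts-⊆ P F∈Fs p) p

-- The first cell that distinguishes two vertices

module _ (G : Graph n) (u v : Fin n) where

  SameNbrs : Subset n → Set
  SameNbrs W = nbrs G W u ≡ nbrs G W v

  -- The loop invariant of make_equitable, for any two vertices u, v of a common cell.
  data FirstDiff (α : List (Subset n)) : Coloring n → Set where
    []    : FirstDiff α []
    here  : ∀ {W π} → ¬ SameNbrs W → W ∈ α → FirstDiff α (W ∷ π)
    there : ∀ {W π} → SameNbrs W → FirstDiff α π → FirstDiff α (W ∷ π)

  FirstDiff-mono : ∀ {α β π} → (∀ {Y} → Y ∈ π → Y ∈ α → Y ∈ β) → FirstDiff α π → FirstDiff β π
  FirstDiff-mono f []          = []
  FirstDiff-mono f (here ¬p q) = here ¬p (f (here refl) q)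
  FirstDiff-mono f (there p d) = there p (FirstDiff-mono (f ∘ there) d)

  FirstDiff-++ : ∀ {α} Fs {π} → (∀ {F} → F ∈ Fs → F ∈ α) →
    (All SameNbrs Fs → FirstDiff α π) → FirstDiff α (Fs ++ π)
  FirstDiff-++ []       i k = k []
  FirstDiff-++ (F ∷ Fs) i k with nbrs G F u ≟ nbrs G F v
  ... | yes p = there p (FirstDiff-++ Fs (i ∘ there) (k ∘ (p ∷_)))
  ... | no ¬p = here ¬p (i (here refl))

  -- The first distinguishing cell belongs to `α`, so it cannot occur among cells outside `α`.
  FirstDiff-prefix : ∀ {α ps qs} → FirstDiff α (ps ++ qs) → All (_∉ α) ps → All SameNbrs ps
  FirstDiff-prefix d           []       = []
  FirstDiff-prefix (here _ p)  (¬p ∷ _) = contradiction p ¬p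
  FirstDiff-prefix (there p d) (_ ∷ ¬s) = p ∷ FirstDiff-prefix d ¬s

  module _ {X Fs L} (P : Parts X (Fs ∷ʳ L)) (same : All SameNbrs Fs) where

    private
      total-∷ʳ : ∀ x → total (λ W → nbrs G W x) Fs + nbrs G L x ≡ nbrs G X x
      total-∷ʳ x = trans (cong (total (λ W → nbrs G W x) Fs +_) (sym (+-identityʳ _)))
        (trans (sym (total-++ (λ W → nbrs G W x) Fs [ L ])) (Parts-nbrs P G x))

    SameNbrs-whole : SameNbrs L → SameNbrs X
    SameNbrs-whole p = trans (sym (total-∷ʳ u))
      (trans (cong₂ _+_ (total-cong same) p) (total-∷ʳ v))

    SameNbrs-last : SameNbrs X → SameNbrs L
    SameNbrs-last p = +-cancelˡ-≡ (total (λ W → nbrs G W v) Fs) _ _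
      (trans (cong (_+ nbrs G L u) (sym (total-cong same)))
        (trans (total-∷ʳ u) (trans p (sym (total-∷ʳ v)))))

  -- The cell P that is being processed no longer distinguishes u from v, and a
  -- largest fragment may stay out of the work list because its number of
  -- neighbours is the difference of those of the whole cell and of the
  -- fragments in front of it.
  refineAll-FirstDiff : ∀ P → SameNbrs P → ∀ π {α} → Disjoint π → FirstDiff (P ∷ α) π →
    FirstDiff (proj₂ (refineAll G P π α)) (proj₁ (refineAll G P π α))
  refineAll-FirstDiff P same [] D [] = []
  refineAll-FirstDiff P same (X ∷ π) {α} D d with ∣ X ∣ ≤ᵇ 1
  ... | true = continue d
    where
    continue : FirstDiff (P ∷ α) (X ∷ π) →
      FirstDiff (proj₂ (refineAll G P π α)) (X ∷ proj₁ (refineAll G P π α))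
    continue (here ¬p (here refl)) = contradiction same ¬p
    continue (here ¬p (there q))   = here ¬p (refineAll-keeps G P π q
      (Parts-fresh D (Parts-trivial (All.head (nonempty D))) (here refl)))
    continue (there p d)           = there p (refineAll-FirstDiff P same π (Disjoint-tail D) d)
  ... | false = FirstDiff-++ Fs
      (λ F∈Fs → refineAll-keeps G P π (enqueue-new X s α F∈Fs) (Parts-fresh D X-parts (∈-++⁺ˡ F∈Fs)))
      continue
    where
    s = shatter G P X
    Fs = proj₁ s
    L = proj₂ s
    X-parts : Parts X (Fs ∷ʳ L)
    X-parts = refineCell-Parts G P (All.head (nonempty D))
    r = refineAll G P π (enqueue X s α)
    keep : ∀ {Y} → Y ∈ π → Y ∈ P ∷ α → Y ∈ P ∷ enqueue X s α
    keep Y∈π (here q)  = here q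
    -- Enqueueing disturbs only the entry `X`; as a part of itself, `X` is not one of the later
    -- cells.
    keep Y∈π (there q) = there (enqueue-keeps s q λ { refl →
      Parts-fresh D (Parts-trivial (All.head (nonempty D))) (here refl) Y∈π })
    inWorkList : ¬ SameNbrs X → FirstDiff (P ∷ α) (X ∷ π) → X ∈ α
    inWorkList ¬p (here _ (here refl)) = contradiction same ¬p
    inWorkList ¬p (here _ (there q))   = q
    inWorkList ¬p (there p _)          = contradiction p ¬p
    rest : SameNbrs X → FirstDiff (P ∷ α) (X ∷ π) → FirstDiff (P ∷ α) π
    rest p (here ¬p _) = contradiction p ¬p
    rest p (there _ d) = d
    continue : All SameNbrs Fs → FirstDiff (proj₂ r) (L ∷ proj₁ r)
    continue ps with nbrs G L u ≟ nbrs G L v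
    ... | yes p = there p (refineAll-FirstDiff P same π (Disjoint-tail D)
      (FirstDiff-mono keep (rest (SameNbrs-whole X-parts ps p) d)))
    ... | no ¬p = here ¬p (refineAll-keeps G P π
      (enqueue-last s (inWorkList (¬p ∘ SameNbrs-last X-parts ps) d))
      (Parts-fresh D X-parts (∈-++⁺ʳ Fs (here refl))))

Guarded : Graph n → Coloring n → List (Subset n) → Set
Guarded G π α = ∀ {X u v} → X ∈ π → lookup X u ≡ true → lookup X v ≡ true → FirstDiff G u v α π

-- For the cells in front of the one chosen from the work list, this says that none of them splits
-- anything. With `ps` the whole coloring, it says that the coloring is equitable.
Guarded-prefix : ∀ {G : Graph n} {π α} → Guarded G π α → ∀ {ps qs} → π ≡ ps ++ qs →
  All (_∉ α) ps → All (λ W → All (Uniform G W) π) ps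
Guarded-prefix {G = G} g refl ∉s = All.tabulate λ W∈ps → All.tabulate λ X∈π u v p q →
  All.lookup (FirstDiff-prefix G u v (g X∈π p q) ∉s) W∈ps

Refines-∈ : ∀ {π ρ : Coloring n} → Refines π ρ → ∀ {F} → F ∈ ρ →
  ∃ λ X → X ∈ π × (∀ {v} → lookup F v ≡ true → lookup X v ≡ true)
Refines-∈ (_∷_ {X = X} {Fs = Fs} P r) F∈ with ∈-++⁻ Fs F∈
... | inj₁ F∈Fs = X , here refl , Parts-⊆ P F∈Fs
... | inj₂ F∈ρ  = let Y , Y∈π , F⊆Y = Refines-∈ r F∈ρ in Y , there Y∈π , F⊆Y

-- Two vertices in a common new cell share an old cell, where the invariant held, and agree on `W`.
-- So `W` may be treated as if it were still in the list, although it has been removed.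
refineAll-Guarded : ∀ {G : Graph n} {π α} W → Disjoint π → Guarded G π α →
  Guarded G (proj₁ (refineAll G W π (removeFirst W α))) (proj₂ (refineAll G W π (removeFirst W α)))
refineAll-Guarded {G = G} {π} {α} W D g {F} {u} {v} F∈ p q
  with F∈split ← subst (F ∈_) (refineAll-cells G W (removeFirst W α) (nonempty D)) F∈
  with X , X∈π , F⊆X ← Refines-∈ (splitBy-Refines G W (nonempty D)) F∈split =
  refineAll-FirstDiff G u v W (All.lookup (splitBy-Uniform G W (nonempty D)) F∈split u v p q) π D
    (FirstDiff-mono G u v keep (g X∈π (F⊆X p) (F⊆X q)))
  where
  keep : ∀ {Y} → Y ∈ π → Y ∈ α → Y ∈ W ∷ removeFirst W α
  keep {Y} _ Y∈α with Vec.≡-dec Bool._≟_ Y W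
  ... | yes e = here e
  ... | no ¬e = there (removeFirst-keeps Y∈α ¬e)

-- The loop computes the closure and has enough fuel

sum≤n : (f : Fin n → ℕ) → (∀ v → f v ≤ 1) → sum f ≤ n
sum≤n {zero}  f p = z≤n
sum≤n {suc n} f p = +-mono-≤ (p zero) (sum≤n (f ∘ suc) (p ∘ suc))

total-size : (π : Coloring n) → total ∣_∣ π ≡ sum (occ π)
total-size π = trans (total-cong (All.universal size≡weight π))
  (trans (total-weight (λ _ → 1) π) (sum-cong-≗ λ v → *-identityʳ (occ π v)))

Disjoint-length : ∀ {π : Coloring n} → Disjoint π → length π ≤ n
Disjoint-length {π = π} D = ≤-trans (length≤total (nonempty D))
  (subst (_≤ _) (sym (total-size π)) (sum≤n (occ π) (once D)))

Equitable⇒Closure : ∀ {G : Graph n} {π} → All Inhabited π → Equitable G π → Closure G π π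
Equitable⇒Closure {G = G} is e =
  stop (findSplit-nothing⁺ G (All.map (λ {W} → splitBy-trivial G W is) e))

isDiscrete⇒Discrete : ∀ (π : Coloring n) → isDiscrete π ≡ true → Discrete π
isDiscrete⇒Discrete []      e = []
isDiscrete⇒Discrete (X ∷ π) e =
  let p , q = ∧-true {∣ X ∣ ≡ᵇ 1} e in ≡ᵇ-true _ _ p ∷ isDiscrete⇒Discrete π q

-- A round removes one entry and adds one for each new cell, so `length α + n` minus `length π`
-- falls by one. Running out of fuel would contradict `length π ≤ n`.
loop-Closure : ∀ f {G : Graph n} π α → Disjoint π → Guarded G π α →
  length α + n < f + length π → Closure G π (loop f G π α)
loop-Closure zero π α D g l =
  contradiction (≤-trans l (Disjoint-length D)) (<⇒≱ (s≤s (m≤n+m _ (length α))))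
loop-Closure (suc f) π [] D g l = Equitable⇒Closure (nonempty D)
  (Guarded-prefix g (sym (++-identityʳ π)) (All.universal (λ _ ()) π))
loop-Closure {n} (suc f) {G} π (A ∷ α) D g l with isDiscrete π in d | firstIn π (A ∷ α) in e
-- The work list may be nonempty here, but singletons are uniform for every cell.
... | true  | _       = Equitable⇒Closure (nonempty D) (Equitable-Discrete G (isDiscrete⇒Discrete π d))
... | false | nothing = Equitable⇒Closure (nonempty D)
  (Guarded-prefix g (sym (++-identityʳ π)) (firstIn-nothing π e))
... | false | just W with firstIn-just π e
...   | ps , qs , π≡ , ps∉ , W∈ = conclude (splitBy G W π ≟ᶜ π)
  where
  α⁻ = removeFirst W (A ∷ α)
  r = refineAll G W π α⁻
  cells : proj₁ r ≡ splitBy G W π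
  cells = refineAll-cells G W α⁻ (nonempty D)
  fuel : length (proj₂ r) + n < f + length (proj₁ r)
  fuel = +-cancelʳ-< (length π) _ _ (begin-strict
    length (proj₂ r) + n + length π     ≡⟨ +-assoc (length (proj₂ r)) n _ ⟩
    length (proj₂ r) + (n + length π)   ≡⟨ cong (length (proj₂ r) +_) (+-comm n _) ⟩
    length (proj₂ r) + (length π + n)   ≡⟨ +-assoc (length (proj₂ r)) _ n ⟨
    length (proj₂ r) + length π + n     ≡⟨ cong (_+ n) (refineAll-length G W π α⁻) ⟩
    length α⁻ + length (proj₁ r) + n    ≡⟨ +-assoc (length α⁻) _ n ⟩
    length α⁻ + (length (proj₁ r) + n)  ≡⟨ cong (length α⁻ +_) (+-comm _ n) ⟩
    length α⁻ + (n + length (proj₁ r))  ≡⟨ +-assoc (length α⁻) n _ ⟨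
    length α⁻ + n + length (proj₁ r)    <⟨ +-monoˡ-< (length (proj₁ r)) (≤-pred l′) ⟩
    f + length π + length (proj₁ r)     ≡⟨ +-assoc f _ _ ⟩
    f + (length π + length (proj₁ r))   ≡⟨ cong (f +_) (+-comm (length π) _) ⟩
    f + (length (proj₁ r) + length π)   ≡⟨ +-assoc f _ _ ⟨
    f + length (proj₁ r) + length π     ∎)
    where
    open ≤-Reasoning
    l′ : suc (length α⁻) + n < suc f + length π
    l′ = subst (λ k → k + n < suc f + length π) (sym (removeFirst-length W∈)) l
  rest : Closure G (splitBy G W π) (loop f G (proj₁ r) (proj₂ r))
  rest = subst (λ ρ → Closure G ρ (loop f G (proj₁ r) (proj₂ r))) cells
    (loop-Closure f (proj₁ r) (proj₂ r)
      (subst Disjoint (sym cells) (Refines-Disjoint (splitBy-Refines G W (nonempty D)) D))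
      (refineAll-Guarded W D g) fuel)
  conclude : Dec (splitBy G W π ≡ π) → Closure G π (loop f G (proj₁ r) (proj₂ r))
  -- `W` splits nothing: the round changes the work list only, and the closure takes no step.
  conclude (yes p) = subst (λ ρ → Closure G ρ (loop f G (proj₁ r) (proj₂ r))) p rest
  conclude (no ¬p) = step
    (trans (cong (λ ρ → findSplit G ρ π) π≡)
      (findSplit-just⁺ G (All.map (λ {V} → splitBy-trivial G V (nonempty D))
        (Guarded-prefix g π≡ ps∉)) ¬p)) rest

makeEquitable-Closure : ∀ {G : Graph n} {π α} → Disjoint π → Guarded G π α →
  Closure G π (makeEquitable G π α)
makeEquitable-Closure {n} {π = π} {α} D g = loop-Closure (suc (length α + n) * suc n) π α D g
  (≤-trans (m≤m*n (suc (length α + n)) (suc n)) (m≤m+n _ (length π)))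

Guarded-all : ∀ {G : Graph n} {π} → Guarded G π π
Guarded-all {G = G} {π} {u = u} {v} _ _ _ =
  subst (FirstDiff G u v π) (++-identityʳ π) (FirstDiff-++ G u v π id λ _ → [])

-- Individualization

-- The local `step` of `ind` under a name of its own; `ind π v` unfolds to
-- `concatMap (indCell v) π`.
indCell : Fin n → Subset n → List (Subset n)
indCell v W = if lookup W v
  then (⁅ v ⁆ ∷ (if ∣ W ─ ⁅ v ⁆ ∣ ≡ᵇ 0 then [] else [ W ─ ⁅ v ⁆ ]))
  else [ W ]

lookup-─ : ∀ (p q : Subset n) x → lookup (p ─ q) x ≡ lookup p x ∧ not (lookup q x)
lookup-─ (a ∷ p) (true  ∷ q) zero    = sym (Bool.∧-zeroʳ a)
lookup-─ (a ∷ p) (false ∷ q) zero    = sym (Bool.∧-identityʳ a)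
lookup-─ (a ∷ p) (true  ∷ q) (suc x) = lookup-─ p q x
lookup-─ (a ∷ p) (false ∷ q) (suc x) = lookup-─ p q x

lookup-⁅⁆ : (v : Fin n) → lookup ⁅ v ⁆ v ≡ true
lookup-⁅⁆ v = []=⇒lookup (Subset.x∈⁅x⁆ v)

lookup-⁅⁆⁻ : ∀ (v x : Fin n) → lookup ⁅ v ⁆ x ≡ true → x ≡ v
lookup-⁅⁆⁻ v x p = Subset.x∈⁅y⁆⇒x≡y v (lookup⇒[]= x ⁅ v ⁆ p)

indCell-Parts : ∀ (v : Fin n) {W} → Inhabited W → Parts W (indCell v W)
indCell-Parts v {W} i with lookup W v in v∈W
... | false = Parts-trivial i
... | true with ∣ W ─ ⁅ v ⁆ ∣ ≡ᵇ 0 in s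
...   | true = parts covering ((v , lookup-⁅⁆ v) ∷ [])
  where
  covering : ∀ x → χ (lookup ⁅ v ⁆ x) + 0 ≡ χ (lookup W x)
  covering x with lookup ⁅ v ⁆ x in p | lookup W x in q
  ... | true  | true  = refl
  ... | true  | false = contradiction (trans (sym q) (trans (cong (lookup W) (lookup-⁅⁆⁻ v x p)) v∈W)) λ ()
  ... | false | false = refl
  -- The remainder of `W` is empty in this branch, whereas `x` would belong to it.
  ... | false | true  = contradiction
    (Inhabited⇒size (W ─ ⁅ v ⁆) (x , trans (lookup-─ W ⁅ v ⁆ x) (cong₂ (λ a b → a ∧ not b) q p)))
    (<⇒≱ (s≤s (≤-reflexive (≡ᵇ-true _ 0 s))))
...   | false = parts covering ((v , lookup-⁅⁆ v) ∷ size⇒Inhabited (W ─ ⁅ v ⁆) (positive _ s) ∷ [])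
  where
  positive : ∀ m → (m ≡ᵇ 0) ≡ false → 1 ≤ m
  positive (suc m) _ = s≤s z≤n
  covering : ∀ x → χ (lookup ⁅ v ⁆ x) + (χ (lookup (W ─ ⁅ v ⁆) x) + 0) ≡ χ (lookup W x)
  covering x rewrite lookup-─ W ⁅ v ⁆ x with lookup ⁅ v ⁆ x in p | lookup W x in q
  ... | true  | true  = refl
  ... | true  | false = contradiction (trans (sym q) (trans (cong (lookup W) (lookup-⁅⁆⁻ v x p)) v∈W)) λ ()
  ... | false | false = refl
  ... | false | true  = refl

ind-Refines : ∀ {π : Coloring n} → All Inhabited π → ∀ v → Refines π (ind π v)
ind-Refines is v = Refines-concatMap (indCell v) (indCell-Parts v) is

-- In an equitable coloring the cell W of v distinguishes no two vertices, hence
-- W ∖ {v} distinguishes only those that {v} distinguishes.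
ind-Guarded : ∀ {G : Graph n} {π} v → Disjoint π → Equitable G π → Guarded G (ind π v) [ ⁅ v ⁆ ]
ind-Guarded {n} {G} {π} v D E {u = u} {w} F∈ p q with Refines-∈ (ind-Refines (nonempty D) v) F∈
... | X , X∈π , F⊆X = diff (nonempty D) (All.map (λ U → All.lookup U X∈π u w (F⊆X p) (F⊆X q)) E)
  where
  diff : ∀ {ρ} → All Inhabited ρ → All (SameNbrs G u w) ρ →
    FirstDiff G u w [ ⁅ v ⁆ ] (concatMap (indCell v) ρ)
  diff []                   []       = []
  diff {Y ∷ ρ} (i ∷ is) (s ∷ ss) with lookup Y v | indCell-Parts v i
  ... | false | _ = there s (diff is ss)
  ... | true  | P with nbrs G ⁅ v ⁆ u ≟ nbrs G ⁅ v ⁆ w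
  ...   | no ¬e = here ¬e (here refl)
  ...   | yes e with ∣ Y ─ ⁅ v ⁆ ∣ ≡ᵇ 0
  ...     | true  = there e (diff is ss)
  ...     | false = there e (there (SameNbrs-last G u w P (e ∷ []) s) (diff is ss))

-- Searches that at most one vertex can satisfy

≡ᵇ-false : ∀ m k → m ≢ k → (m ≡ᵇ k) ≡ false
≡ᵇ-false m k ¬p with m ≡ᵇ k in e
... | true  = contradiction (≡ᵇ-true m k e) ¬p
... | false = refl

or-false : (q : Fin n → Bool) → (∀ y → q y ≡ false) → or (tabulate q) ≡ false
or-false {zero}  q p = refl
or-false {suc n} q p rewrite p zero = or-false (q ∘ suc) (p ∘ suc)

or-unique : (q : Fin n → Bool) (x : Fin n) → (∀ y → y ≢ x → q y ≡ false) → or (tabulate q) ≡ q x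
or-unique q zero    p rewrite or-false (q ∘ suc) (λ y → p (suc y) λ ()) = Bool.∨-identityʳ (q zero)
or-unique q (suc x) p rewrite p zero (λ ()) =
  or-unique (q ∘ suc) x (λ y ¬e → p (suc y) (¬e ∘ Fin.suc-injective))

-- The actions search all vertices for a preimage; for an injective map only one candidate `x` can
-- succeed.
anyV-unique : (q : Fin n → Bool) (x : Fin n) → (∀ y → y ≢ x → q y ≡ false) → anyV q ≡ q x
anyV-unique q x p = trans (cong or (map-tabulate id q)) (or-unique q x p)

-- The action on graphs and colorings

module _ {f : Fin n → ℕ} (f-injective : Injective _≡_ _≡_ f) where

  lookup-actS : ∀ S {u x} → f u ≡ toℕ x → lookup (actS f S) x ≡ lookup S u
  lookup-actS S {u} {x} fu≡x = trans (lookup∘tabulate _ x) (trans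
    (anyV-unique (λ y → (f y ≡ᵇ toℕ x) ∧ lookup S y) u
      λ y y≢u → cong (_∧ lookup S y) (≡ᵇ-false _ _ λ e → y≢u (f-injective (trans e (sym fu≡x)))))
    (cong (_∧ lookup S u) (trans (cong (_≡ᵇ toℕ x) fu≡x) (≡ᵇ-refl (toℕ x)))))

  -- The map goes to the naturals so that the lemma serves both permutations and discrete colorings.
  adj-actG : ∀ G {u v x y} → f u ≡ toℕ x → f v ≡ toℕ y → adj (actG f G) x y ≡ adj G u v
  adj-actG G {u} {v} {x} {y} fu≡x fv≡y = begin
    adj (actG f G) x y
      ≡⟨ cong (λ r → lookup r y) (lookup∘tabulate _ x) ⟩
    lookup (Vec.tabulate λ y → anyV λ a → anyV λ b → (f a ≡ᵇ toℕ x) ∧ ((f b ≡ᵇ toℕ y) ∧ adj G a b)) y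
      ≡⟨ lookup∘tabulate _ y ⟩
    anyV (λ a → anyV λ b → (f a ≡ᵇ toℕ x) ∧ ((f b ≡ᵇ toℕ y) ∧ adj G a b))
      -- For `a` other than `u` all values of the inner search are false, and `v` is just a vertex
      -- at which to evaluate it.
      ≡⟨ anyV-unique _ u (λ a a≢u → trans (anyV-unique _ v λ b _ → outside a a≢u _) (outside a a≢u _)) ⟩
    anyV (λ b → (f u ≡ᵇ toℕ x) ∧ ((f b ≡ᵇ toℕ y) ∧ adj G u b))
      ≡⟨ anyV-unique _ v (λ b b≢v → trans
           (cong (λ c → (f u ≡ᵇ toℕ x) ∧ (c ∧ adj G u b))
             (≡ᵇ-false _ _ λ e → b≢v (f-injective (trans e (sym fv≡y)))))
           (Bool.∧-zeroʳ (f u ≡ᵇ toℕ x))) ⟩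
    (f u ≡ᵇ toℕ x) ∧ ((f v ≡ᵇ toℕ y) ∧ adj G u v)
      ≡⟨ cong₂ (λ c d → c ∧ (d ∧ adj G u v)) (matches fu≡x) (matches fv≡y) ⟩
    adj G u v ∎
    where
    open ≡-Reasoning
    outside : ∀ a → a ≢ u → ∀ c → (f a ≡ᵇ toℕ x) ∧ c ≡ false
    outside a a≢u c = cong (_∧ c) (≡ᵇ-false _ _ λ e → a≢u (f-injective (trans e (sym fu≡x))))
    matches : ∀ {k m} → k ≡ m → (k ≡ᵇ m) ≡ true
    matches {k} refl = ≡ᵇ-refl k

-- The 0-based index of the target cell, if there is one. It is the position that a vertex
-- individualized in that cell obtains.
lead : Coloring n → ℕ
lead []      = 0
lead (X ∷ π) = if 2 ≤ᵇ ∣ X ∣ then 0 else suc (lead π)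

module Action (σ : Permutation′ n) where

  permMap-injective : Injective _≡_ _≡_ (permMap σ)
  permMap-injective {u} {v} e =
    trans (sym (inverseˡ σ)) (trans (cong (σ ⟨$⟩ˡ_) (Fin.toℕ-injective e)) (inverseˡ σ))

  σ-surjective : ∀ {P : Fin n → Set} → (∀ v → P (σ ⟨$⟩ʳ v)) → ∀ x → P x
  σ-surjective {P} p x = subst P (inverseʳ σ) (p (σ ⟨$⟩ˡ x))

  act : Subset n → Subset n
  act = actS (permMap σ)

  lookup-act : ∀ X v → lookup (act X) (σ ⟨$⟩ʳ v) ≡ lookup X v
  lookup-act X v = lookup-actS permMap-injective X refl

  act-ext : ∀ X {Y} → (∀ v → lookup Y (σ ⟨$⟩ʳ v) ≡ lookup X v) → Y ≡ act X
  act-ext X {Y} p = Subset-ext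
    (σ-surjective {λ x → lookup Y x ≡ lookup (act X) x} λ v → trans (p v) (sym (lookup-act X v)))

  act-injective : ∀ {X Y} → act X ≡ act Y → X ≡ Y
  act-injective {X} {Y} e = Subset-ext λ v →
    trans (sym (lookup-act X v)) (trans (cong (λ Z → lookup Z (σ ⟨$⟩ʳ v)) e) (lookup-act Y v))

  act-size : ∀ X → ∣ act X ∣ ≡ ∣ X ∣
  act-size X = begin
    ∣ act X ∣                                       ≡⟨ size≡weight (act X) ⟩
    weight (λ _ → 1) (act X)                        ≡⟨ sum-permute (λ v → χ (lookup (act X) v) * 1) σ ⟩
    sum (λ v → χ (lookup (act X) (σ ⟨$⟩ʳ v)) * 1)   ≡⟨ sum-cong-≗ (λ v → cong (λ b → χ b * 1) (lookup-act X v)) ⟩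
    weight (λ _ → 1) X                              ≡⟨ size≡weight X ⟨
    ∣ X ∣                                           ∎
    where open ≡-Reasoning

  act-lead : ∀ π → lead (map act π) ≡ lead π
  act-lead []      = refl
  act-lead (X ∷ π) = cong₂ (λ s l → if 2 ≤ᵇ s then 0 else suc l) (act-size X) (act-lead π)

  act-ind : ∀ π v → ind (map act π) (σ ⟨$⟩ʳ v) ≡ map act (ind π v)
  act-ind π v = go π
    where
    act-⁅⁆ : ⁅ σ ⟨$⟩ʳ v ⁆ ≡ act ⁅ v ⁆
    act-⁅⁆ = act-ext ⁅ v ⁆ same
      where
      same : ∀ x → lookup ⁅ σ ⟨$⟩ʳ v ⁆ (σ ⟨$⟩ʳ x) ≡ lookup ⁅ v ⁆ x
      same x with lookup ⁅ σ ⟨$⟩ʳ v ⁆ (σ ⟨$⟩ʳ x) in p | lookup ⁅ v ⁆ x in q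
      ... | true  | true  = refl
      ... | false | false = refl
      ... | true  | false = contradiction (trans (sym q) (trans
        (cong (lookup ⁅ v ⁆) (permMap-injective (cong toℕ (lookup-⁅⁆⁻ _ _ p)))) (lookup-⁅⁆ v))) λ ()
      ... | false | true  = contradiction (trans (sym p) (trans
        (cong (λ y → lookup ⁅ σ ⟨$⟩ʳ v ⁆ (σ ⟨$⟩ʳ y)) (lookup-⁅⁆⁻ v x q)) (lookup-⁅⁆ (σ ⟨$⟩ʳ v)))) λ ()
    act-─ : ∀ W → act W ─ ⁅ σ ⟨$⟩ʳ v ⁆ ≡ act (W ─ ⁅ v ⁆)
    act-─ W = act-ext (W ─ ⁅ v ⁆) λ x → trans (lookup-─ (act W) _ (σ ⟨$⟩ʳ x)) (trans
      (cong₂ (λ a b → a ∧ not b) (lookup-act W x)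
        (trans (cong (λ Z → lookup Z (σ ⟨$⟩ʳ x)) act-⁅⁆) (lookup-act ⁅ v ⁆ x)))
      (sym (lookup-─ W ⁅ v ⁆ x)))
    act-indCell : ∀ W → indCell (σ ⟨$⟩ʳ v) (act W) ≡ map act (indCell v W)
    act-indCell W rewrite lookup-act W v with lookup W v
    ... | false = refl
    ... | true rewrite act-─ W | act-size (W ─ ⁅ v ⁆) | act-⁅⁆ with ∣ W ─ ⁅ v ⁆ ∣ ≡ᵇ 0
    ...   | true  = refl
    ...   | false = refl
    go : ∀ π → concatMap (indCell (σ ⟨$⟩ʳ v)) (map act π) ≡ map act (concatMap (indCell v) π)
    go []      = refl
    go (W ∷ π) = trans (cong₂ _++_ (act-indCell W) (go π)) (sym (map-++ act (indCell v W) _))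

  module Equivariance (G : Graph n)
    (aut : ∀ u v → adj G (σ ⟨$⟩ʳ u) (σ ⟨$⟩ʳ v) ≡ adj G u v) where

    act-nbrs : ∀ W x → nbrs G (act W) (σ ⟨$⟩ʳ x) ≡ nbrs G W x
    act-nbrs W x = begin
      nbrs G (act W) (σ ⟨$⟩ʳ x)
        ≡⟨ nbrs≡weight G (act W) (σ ⟨$⟩ʳ x) ⟩
      sum (λ u → χ (lookup (act W) u) * χ (adj G (σ ⟨$⟩ʳ x) u))
        ≡⟨ sum-permute (λ u → χ (lookup (act W) u) * χ (adj G (σ ⟨$⟩ʳ x) u)) σ ⟩
      sum (λ u → χ (lookup (act W) (σ ⟨$⟩ʳ u)) * χ (adj G (σ ⟨$⟩ʳ x) (σ ⟨$⟩ʳ u)))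
        ≡⟨ sum-cong-≗ (λ u → cong₂ (λ a b → χ a * χ b) (lookup-act W u) (aut x u)) ⟩
      weight (χ ∘ adj G x) W
        ≡⟨ nbrs≡weight G W x ⟨
      nbrs G W x ∎
      where open ≡-Reasoning

    act-fragment : ∀ W X k → fragment G (act W) (act X) k ≡ act (fragment G W X k)
    act-fragment W X k = act-ext (fragment G W X k) λ v → trans (lookup-fragment G (act W) (act X) k _)
      (trans (cong₂ (λ a m → a ∧ (m ≡ᵇ k)) (lookup-act X v) (act-nbrs W v))
        (sym (lookup-fragment G W X k v)))

    act-filter : ∀ Fs → filter nonempty? (map act Fs) ≡ map act (filter nonempty? Fs)
    act-filter []       = refl
    act-filter (F ∷ Fs) with 1 ≤ᵇ ∣ act F ∣ | 1 ≤ᵇ ∣ F ∣ | cong (1 ≤ᵇ_) (act-size F)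
    ... | true  | true  | _ = cong (act F ∷_) (act-filter Fs)
    ... | false | false | _ = act-filter Fs

    act-fragments : ∀ W X → fragments G (act W) (act X) ≡ map act (fragments G W X)
    act-fragments W X = trans
      (cong (filter nonempty?) (trans (map-cong (act-fragment W X) (upTo (suc n)))
        (map-∘ {g = act} {f = fragment G W X} (upTo (suc n)))))
      (act-filter (map (fragment G W X) (upTo (suc n))))

    act-maxSize : ∀ Fs → maxSize (map act Fs) ≡ maxSize Fs
    act-maxSize []       = refl
    act-maxSize (F ∷ Fs) = cong₂ _⊔_ (act-size F) (act-maxSize Fs)

    -- This handles the default value of `extract` on the empty list.
    act-∅ : ∅ ≡ act ∅
    act-∅ = act-ext ∅ λ v → trans (Vec.lookup-replicate (σ ⟨$⟩ʳ v) false) (sym (Vec.lookup-replicate v false))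

    act-extract : ∀ m Fs →
      extract m (map act Fs) ≡ (map act (proj₁ (extract m Fs)) , act (proj₂ (extract m Fs)))
    act-extract m []       = cong ([] ,_) act-∅
    act-extract m (F ∷ Fs) with ∣ act F ∣ ≡ᵇ m | ∣ F ∣ ≡ᵇ m | cong (_≡ᵇ m) (act-size F)
    ... | true  | true  | _ = refl
    ... | false | false | _ = cong (λ (Es , E) → (act F ∷ Es) , E) (act-extract m Fs)

    act-refineCell : ∀ W X → refineCell G (act W) (act X) ≡ map act (refineCell G W X)
    act-refineCell W X = trans (cong (λ (Es , E) → Es ∷ʳ E) act-shatter)
      (sym (map-++ act (proj₁ (shatter G W X)) _))
      where
      act-shatter : shatter G (act W) (act X)
        ≡ (map act (proj₁ (shatter G W X)) , act (proj₂ (shatter G W X)))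
      act-shatter = trans
        (cong₂ extract (trans (cong maxSize (act-fragments W X)) (act-maxSize (fragments G W X)))
          (act-fragments W X))
        (act-extract (maxSize (fragments G W X)) (fragments G W X))

    act-splitBy : ∀ W π → splitBy G (act W) (map act π) ≡ map act (splitBy G W π)
    act-splitBy W []      = refl
    act-splitBy W (X ∷ π) =
      trans (cong₂ _++_ (act-refineCell W X) (act-splitBy W π)) (sym (map-++ act (refineCell G W X) _))

    -- Splitting commutes with the action, and the action is injective, so a split is trivial
    -- exactly when its image is.
    act-findSplit : ∀ Ws π → findSplit G (map act Ws) (map act π) ≡ Maybe.map act (findSplit G Ws π)
    act-findSplit []       π = refl
    act-findSplit (W ∷ Ws) π with splitBy G (act W) (map act π) ≟ᶜ map act π | splitBy G W π ≟ᶜ π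
    ... | yes _ | yes _ = act-findSplit Ws π
    ... | no  _ | no  _ = refl
    ... | yes p | no ¬q = contradiction (map-injective act-injective (trans (sym (act-splitBy W π)) p)) ¬q
    ... | no ¬p | yes q = contradiction (trans (act-splitBy W π) (cong (map act) q)) ¬p

    act-Closure : ∀ {π ρ} → Closure G π ρ → Closure G (map act π) (map act ρ)
    act-Closure {π} (stop e) = stop (trans (act-findSplit π π) (cong (Maybe.map act) e))
    act-Closure {π} (step {W = W} e c) = step (trans (act-findSplit π π) (cong (Maybe.map act) e))
      (subst (λ ρ → Closure G ρ _) (sym (act-splitBy W π)) (act-Closure c))

-- Discrete colorings as permutations

record Partition (π : Coloring n) : Set where
  constructor partition
  field
    exactlyOnce : ∀ v → occ π v ≡ 1
    nonempty    : All Inhabited π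
open Partition public using (exactlyOnce)

Partition⇒Disjoint : ∀ {π : Coloring n} → Partition π → Disjoint π
Partition⇒Disjoint (partition o i) = disjoint (λ v → ≤-reflexive (o v)) i

Refines-Partition : ∀ {π ρ : Coloring n} → Refines π ρ → Partition π → Partition ρ
Refines-Partition r P = partition (λ v → trans (Refines-occ r v) (exactlyOnce P v)) (Refines-inhabited r)

IsColoring⇒Partition : ∀ {π : Coloring n} → IsColoring π → Partition π
IsColoring⇒Partition {π = π} (i , o) = partition
  (λ v → trans (sym (cellsContaining≡occ π v)) (o v))
  (All.map (λ (v , v∈X) → v , []=⇒lookup v∈X) i)

Discrete-total : ∀ {π : Coloring n} → Discrete π → total ∣_∣ π ≡ length π
Discrete-total []       = refl
Discrete-total (s ∷ ss) = cong₂ _+_ s (Discrete-total ss)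

sum-ones : (f : Fin n → ℕ) → (∀ v → f v ≡ 1) → sum f ≡ n
sum-ones {zero}  f p = refl
sum-ones {suc n} f p = cong₂ _+_ (p zero) (sum-ones (f ∘ suc) (p ∘ suc))

Discrete-length : ∀ {π : Coloring n} → Partition π → Discrete π → length π ≡ n
Discrete-length {π = π} P d = trans (sym (Discrete-total d))
  (trans (total-size π) (sum-ones (occ π) (exactlyOnce P)))

Discrete-col-injective : ∀ {π : Coloring n} → Discrete π → ∀ {u v} → 1 ≤ occ π u → 1 ≤ occ π v →
  col π u ≡ col π v → u ≡ v
Discrete-col-injective {π = X ∷ π} (s ∷ ss) {u} {v} p q e with lookup X u in eu | lookup X v in ev
... | true  | true  = size≤1⇒unique X (≤-reflexive s) eu ev
... | false | false = Discrete-col-injective ss p q (suc-injective e)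

-- The conclusion also carries that some cell contains `v`; by disjointness this keeps `v` out of
-- the cell `X` put in front.
col-surjective : ∀ {π : Coloring n} → Disjoint π → ∀ {k} → k < length π →
  ∃ λ v → col π v ≡ k × 1 ≤ occ π v
col-surjective {π = X ∷ π} D {zero} _ with All.head (nonempty D)
... | v , p = v , cong (λ b → if b then 0 else suc (col π v)) p ,
  subst (λ b → 1 ≤ χ b + occ π v) (sym p) (s≤s z≤n)
col-surjective {π = X ∷ π} D {suc k} (s≤s l) with col-surjective (Disjoint-tail D) l
... | v , e , p with lookup X v in q
...   | true  = let Y , Y∈π , r = occ⇒∈ π v p in contradiction r (Disjoint-head D Y∈π q)
...   | false = v , trans (cong (λ b → if b then 0 else suc (col π v)) q) (cong suc e) ,
  subst (λ b → 1 ≤ χ b + occ π v) (sym q) p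

col<n : ∀ {ρ : Coloring n} → Partition ρ → Discrete ρ → ∀ v → col ρ v < n
col<n {ρ = ρ} P d v = subst (col ρ v <_) (Discrete-length P d)
  (proj₂ (col-++ˡ ρ {[]} (≤-reflexive (sym (exactlyOnce P v)))))

transport : ∀ {ρ₁ ρ₂ : Coloring n} → Partition ρ₁ → Partition ρ₂ → Discrete ρ₁ → Discrete ρ₂ →
  ∀ v → ∃ λ w → col ρ₂ w ≡ col ρ₁ v
transport {ρ₁ = ρ₁} P₁ P₂ d₁ d₂ v =
  let w , e , _ = col-surjective (Partition⇒Disjoint P₂)
        (subst (col ρ₁ v <_) (sym (Discrete-length P₂ d₂)) (col<n P₁ d₁ v))
  in w , e

col-injective : ∀ {ρ : Coloring n} → Partition ρ → Discrete ρ → Injective _≡_ _≡_ (col ρ)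
col-injective P d = Discrete-col-injective d
  (≤-reflexive (sym (exactlyOnce P _))) (≤-reflexive (sym (exactlyOnce P _)))

module _ {ρ₁ ρ₂ : Coloring n} (P₁ : Partition ρ₁) (P₂ : Partition ρ₂)
  (d₁ : Discrete ρ₁) (d₂ : Discrete ρ₂) where

  -- As permutations: `ρ₁` followed by the inverse of `ρ₂`. It sends each vertex to the one at the
  -- same position in the other coloring.
  matching : Permutation′ n
  matching = permutation (proj₁ ∘ to) (proj₁ ∘ from)
    (λ w → col-injective P₂ d₂ (trans (proj₂ (to _)) (proj₂ (from w))))
    (λ v → col-injective P₁ d₁ (trans (proj₂ (from _)) (proj₂ (to v))))
    where
    to   = transport P₁ P₂ d₁ d₂
    from = transport P₂ P₁ d₂ d₁

  col-matching : ∀ v → col ρ₂ (matching ⟨$⟩ʳ v) ≡ col ρ₁ v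
  col-matching v = proj₂ (transport P₁ P₂ d₁ d₂ v)

  -- Both sides are the adjacency of the same two positions in the common image graph.
  adj-matching : ∀ G → graphBy ρ₁ G ≡ graphBy ρ₂ G →
    ∀ u v → adj G (matching ⟨$⟩ʳ u) (matching ⟨$⟩ʳ v) ≡ adj G u v
  adj-matching G e u v = begin
    adj G (matching ⟨$⟩ʳ u) (matching ⟨$⟩ʳ v)
      ≡⟨ adj-actG (col-injective P₂ d₂) G (trans (col-matching u) (at u)) (trans (col-matching v) (at v)) ⟨
    adj (graphBy ρ₂ G) (place u) (place v)
      ≡⟨ cong (λ G′ → adj G′ (place u) (place v)) e ⟨
    adj (graphBy ρ₁ G) (place u) (place v)
      ≡⟨ adj-actG (col-injective P₁ d₁) G (at u) (at v) ⟩
    adj G u v ∎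
    where
    open ≡-Reasoning
    place : Fin n → Fin n
    place v = fromℕ< (col<n P₁ d₁ v)
    at : ∀ v → col ρ₁ v ≡ toℕ (place v)
    at v = sym (Fin.toℕ-fromℕ< (col<n P₁ d₁ v))

-- The cells of π₀ occupy in any discrete refinement consecutive blocks of
-- positions whose lengths are the sizes of the cells.
same-cells : ∀ {π₀ ρ₁ ρ₂ : Coloring n} → Disjoint π₀ → Refines π₀ ρ₁ → Refines π₀ ρ₂ →
  Discrete ρ₁ → Discrete ρ₂ → ∀ {v w} → col ρ₁ v ≡ col ρ₂ w → All (λ X → lookup X v ≡ lookup X w) π₀
same-cells D [] [] d₁ d₂ e = []
same-cells {π₀ = X ∷ π} D (_∷_ {Fs = Fs} P₁ r₁) (_∷_ {Fs = Hs} P₂ r₂) d₁ d₂ {v} {w} e = cases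
  where
  lengths : length Fs ≡ length Hs
  lengths = trans (sym (Discrete-total (All.++⁻ˡ Fs d₁)))
    (trans (trans (Parts-size P₁) (sym (Parts-size P₂))) (Discrete-total (All.++⁻ˡ Hs d₂)))
  outside : ∀ {Y x} → Y ∈ π → lookup X x ≡ true → lookup Y x ≡ false
  outside {Y} {x} Y∈π p with lookup Y x in q
  ... | true  = contradiction q (Disjoint-head D Y∈π p)
  ... | false = refl
  cases : All (λ X → lookup X v ≡ lookup X w) (X ∷ π)
  cases with lookup X v in p | lookup X w in q
  ... | true  | true  = trans p (sym q) ∷
    All.tabulate λ Y∈π → trans (outside Y∈π p) (sym (outside Y∈π q))
  ... | false | false = trans p (sym q) ∷ same-cells (Disjoint-tail D) r₁ r₂ (All.++⁻ʳ Fs d₁) (All.++⁻ʳ Hs d₂)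
    (+-cancelˡ-≡ (length Fs) _ _ (trans (sym (col-Parts-outside P₁ p))
      (trans e (trans (col-Parts-outside P₂ q) (cong (_+ _) (sym lengths))))))
  ... | true  | false = contradiction
    (subst₂ _<_ (trans e (col-Parts-outside P₂ q)) lengths (col-Parts-inside P₁ p))
    (m+n≮m (length Hs) _)
  ... | false | true  = contradiction
    (subst₂ _<_ (trans (sym e) (col-Parts-outside P₁ p)) (sym lengths) (col-Parts-inside P₂ q))
    (m+n≮m (length Fs) _)

-- A vertex and its image have equal positions and hence lie in the same cell of `π₀`, so each cell
-- is mapped to itself. Edges are preserved by `adj-matching`.
matching-IsAut : ∀ {G : Graph n} {π₀ ρ₁ ρ₂} (P₁ : Partition ρ₁) (P₂ : Partition ρ₂)
  (d₁ : Discrete ρ₁) (d₂ : Discrete ρ₂) → Disjoint π₀ → Refines π₀ ρ₁ → Refines π₀ ρ₂ →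
  graphBy ρ₁ G ≡ graphBy ρ₂ G → IsAut G π₀ (matching P₁ P₂ d₁ d₂)
matching-IsAut {n} {G} {π₀} P₁ P₂ d₁ d₂ D r₁ r₂ e = graph , cells (All.tabulate λ X∈π₀ v →
    All.lookup (same-cells D r₂ r₁ d₂ d₁ (col-matching P₁ P₂ d₁ d₂ v)) X∈π₀)
  where
  σ = matching P₁ P₂ d₁ d₂
  open Action σ
  graph : actG (permMap σ) G ≡ G
  graph = Graph-ext (σ-surjective λ u → σ-surjective λ v →
    trans (adj-actG permMap-injective G refl refl) (sym (adj-matching P₁ P₂ d₁ d₂ G e u v)))
    where
    Graph-ext : ∀ {G G′ : Graph n} → (∀ x y → adj G x y ≡ adj G′ x y) → G ≡ G′
    Graph-ext {G} {G′} p = trans (sym (tabulate∘lookup G))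
      (trans (tabulate-cong λ x → Subset-ext (p x)) (tabulate∘lookup G′))
  cells : ∀ {π} → All (λ X → ∀ v → lookup X (σ ⟨$⟩ʳ v) ≡ lookup X v) π → map act π ≡ π
  cells []       = refl
  cells {X ∷ _} (p ∷ ps) = cong₂ _∷_ (sym (act-ext X p)) (cells ps)

-- Prefixes and the lexicographic order

module _ {A : Set} where

  drop-inits-∷ʳ : ∀ (xs : List A) x → drop 1 (inits (xs ∷ʳ x)) ≡ drop 1 (inits xs) ∷ʳ (xs ∷ʳ x)
  drop-inits-∷ʳ []       x = refl
  drop-inits-∷ʳ (y ∷ xs) x = cong ([ y ] ∷_)
    (trans (cong (map (y ∷_)) (drop-inits-∷ʳ xs x)) (map-++ (y ∷_) (drop 1 (inits xs)) _))

  module _ {_<_ : Rel A 0ℓ} where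

    Lex-prefix : ∀ xs {y ys} → Lex-< _≡_ _<_ xs (xs ++ y ∷ ys)
    Lex-prefix []       = halt
    Lex-prefix (x ∷ xs) = next refl (Lex-prefix xs)

    Lex-++ : ∀ xs {x y ys zs} → x < y → Lex-< _≡_ _<_ (xs ++ x ∷ ys) (xs ++ y ∷ zs)
    Lex-++ []       x<y = this x<y
    Lex-++ (x ∷ xs) x<y = next refl (Lex-++ xs x<y)

≤ᵇ-false : ∀ m k → (m ≤ᵇ k) ≡ false → k < m
≤ᵇ-false m k e = ≰⇒> λ m≤k → subst T e (≤⇒≤ᵇ m≤k)

-- The search tree and derivability of its colorings

module SearchTree (G : Graph n) (π₀ : Coloring n) (P₀ : Partition π₀)
  {H : Set} (_<H_ : Rel H 0ℓ) (hash : Graph n → Coloring n → H) (_<G_ : Rel (Graph n) 0ℓ) where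

  open Canon G π₀ _<H_ hash _<G_

  -- `Rbar` recurses on the reversed sequence; abstracting that list together with its value lets
  -- the recursion compute.
  Rbar-∷ʳ : ∀ ν v → Rbar (ν ∷ʳ v) ≡ makeEquitable G (ind (Rbar ν) v) [ ⁅ v ⁆ ]
  Rbar-∷ʳ ν v with List.reverse (ν ∷ʳ v) | List.reverse-++ ν [ v ]
  ... | _ | refl = refl

  -- Each `step` is one use of SplitColoring and `stop` is one of Equitable. Cells before the chosen
  -- index leave `π` equal to its split, so they fail the inequality in `≺`.
  Closure-Derivable : ∀ {ν π ρ} → Disjoint π → Derivable (R⪯ ν π) → Closure G π ρ → Derivable (R≡ ν ρ)
  Closure-Derivable {π = π} D d (stop e) =
    equitable d λ i → All.lookup (findSplit-nothing⁻ G π e) (∈-lookup i)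
  Closure-Derivable {π = π} D d (step {W = W} e c) with findSplit-just⁻ G π e
  ... | i , refl , nontrivial , minimal =
    let r = splitBy-Refines G W (nonempty D)
    in Closure-Derivable (Refines-Disjoint r D)
         (splitColoring d i (Refines⇒⪯ r , nontrivial) λ j j<i (_ , ≢π) → ≢π (minimal j j<i)) c

  -- Bundled for a single induction along `ν`: equitability of the parent is what makes refinement
  -- after an individualization reach the closure, and derivability at the parent starts the
  -- derivation at the child.
  record Facts (ν : Seq n) : Set where
    field
      isPartition : Partition (Rbar ν)
      isEquitable : Equitable G (Rbar ν)
      refines     : Refines π₀ (Rbar ν)
      derivable   : Derivable (R≡ ν (Rbar ν))
    isDisjoint : Disjoint (Rbar ν)
    isDisjoint = Partition⇒Disjoint isPartition
    isInhabited : All Inhabited (Rbar ν)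
    isInhabited = nonempty isDisjoint
  open Facts

  Closure-Facts : ∀ {ν π} → Refines π₀ π → Derivable (R⪯ ν π) → Closure G π (Rbar ν) → Facts ν
  Closure-Facts {ν} r d c = record
    { isPartition = Refines-Partition r′ P₀
    ; isEquitable = Closure-Equitable is c
    ; refines     = r′
    ; derivable   = Closure-Derivable (Refines-Disjoint r (Partition⇒Disjoint P₀)) d c
    }
    where
    is = Refines-inhabited r
    r′ : Refines π₀ (Rbar ν)
    r′ = Refines-trans r (Closure-Refines is c)

  Rbar-[]-Closure : Closure G π₀ (Rbar [])
  Rbar-[]-Closure = makeEquitable-Closure (Partition⇒Disjoint P₀) Guarded-all

  Facts-∷ʳ-Closure : ∀ {ν} → Facts ν → ∀ v → Closure G (ind (Rbar ν) v) (Rbar (ν ∷ʳ v))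
  Facts-∷ʳ-Closure {ν} F v = subst (Closure G (ind (Rbar ν) v)) (sym (Rbar-∷ʳ ν v))
    (makeEquitable-Closure (Refines-Disjoint (ind-Refines (isInhabited F) v) (isDisjoint F))
      (ind-Guarded v (isDisjoint F) (isEquitable F)))

  facts : ∀ ν → Facts ν
  facts ν = go (reverseView ν)
    where
    go : ∀ {ν} → Reverse ν → Facts ν
    go []            = Closure-Facts (Refines-refl (nonempty (Partition⇒Disjoint P₀)))
      coloringAxiom Rbar-[]-Closure
    go (_ ∶ rs ∶ʳ v) = let F = go rs in Closure-Facts
      (Refines-trans (refines F) (ind-Refines (isInhabited F) v))
      (individualize (derivable F) v) (Facts-∷ʳ-Closure F v)

  Rbar-∷ʳ-Closure : ∀ ν v → Closure G (ind (Rbar ν) v) (Rbar (ν ∷ʳ v))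
  Rbar-∷ʳ-Closure ν = Facts-∷ʳ-Closure (facts ν)

  Rbar-∷ʳ-Refines : ∀ ν v → Refines (ind (Rbar ν) v) (Rbar (ν ∷ʳ v))
  Rbar-∷ʳ-Refines ν v = Closure-Refines
    (Refines-inhabited (ind-Refines (isInhabited (facts ν)) v)) (Rbar-∷ʳ-Closure ν v)

  Rbar-++-Refines : ∀ ν τ → Refines (Rbar ν) (Rbar (ν ++ τ))
  Rbar-++-Refines ν []      = subst (Refines (Rbar ν)) (cong Rbar (sym (++-identityʳ ν)))
    (Refines-refl (isInhabited (facts ν)))
  Rbar-++-Refines ν (v ∷ τ) = Refines-trans (ind-Refines (isInhabited (facts ν)) v)
    (Refines-trans (Rbar-∷ʳ-Refines ν v)
      (subst (Refines (Rbar (ν ∷ʳ v))) (cong Rbar (∷ʳ-++ ν v τ)) (Rbar-++-Refines (ν ∷ʳ v) τ)))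

  -- The target cell

  target : ∀ {π} → All Inhabited π → Discrete π ⊎ ∃ λ i → 1 < ∣ cell π i ∣ ×
    (∀ j → toℕ j < toℕ i → ∣ cell π j ∣ ≤ 1) × cell π i ≡ firstNonSingleton π
  target [] = inj₁ []
  target {X ∷ π} (p ∷ ps) with 2 ≤ᵇ ∣ X ∣ in s
  ... | true  = inj₂ (zero , ≤ᵇ⇒≤ 2 _ (T⁺ s) , (λ _ ()) , refl)
  ... | false with target ps
  ...   | inj₁ d = inj₁ (≤-antisym (≤-pred (≤ᵇ-false 2 _ s)) (Inhabited⇒size X p) ∷ d)
  ...   | inj₂ (i , l , minimal , e) = inj₂ (suc i , l , below , e)
    where
    below : ∀ j → toℕ j < suc (toℕ i) → ∣ cell (X ∷ π) j ∣ ≤ 1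
    below zero    _         = ≤-pred (≤ᵇ-false 2 _ s)
    below (suc j) (s≤s j<i) = minimal j j<i

  data Shape (ν : Seq n) : Set where
    leaf  : Discrete (Rbar ν) → Shape ν
    inner : Derivable (T≡ ν (Tbar ν)) → Inhabited (Tbar ν) → Shape ν

  shape : ∀ ν → Shape ν
  shape ν with target (isInhabited (facts ν))
  ... | inj₁ d                     = leaf d
  ... | inj₂ (i , l , minimal , e) = inner
    (subst (λ W → Derivable (T≡ ν W)) e (targetCell (derivable (facts ν)) i l minimal))
    (size⇒Inhabited _ (subst (λ W → 1 ≤ ∣ W ∣) e (<⇒≤ l)))

  Discrete-target : ∀ {π} → Discrete π → ∀ v → lookup (firstNonSingleton π) v ≢ true
  Discrete-target []             v p = contradiction (trans (sym p) (Vec.lookup-replicate v false)) λ ()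
  Discrete-target {X ∷ π} (s ∷ ss) v p rewrite s = Discrete-target ss v p

  target-∈ : ∀ π {v} → lookup (firstNonSingleton π) v ≡ true → firstNonSingleton π ∈ π
  target-∈ []      {v} p = contradiction (trans (sym p) (Vec.lookup-replicate v false)) λ ()
  target-∈ (X ∷ π) p with 2 ≤ᵇ ∣ X ∣
  ... | true  = here refl
  ... | false = there (target-∈ π p)

  -- The target cell has a second vertex, so individualizing `v` leaves two nonempty cells in its
  -- place, and no other cell disappears.
  ind-length : ∀ {π v} → All Inhabited π → lookup (firstNonSingleton π) v ≡ true →
    length π < length (ind π v)
  ind-length {[]} {v} is p = contradiction (trans (sym p) (Vec.lookup-replicate v false)) λ ()
  ind-length {X ∷ π} {v} (i ∷ is) p with 2 ≤ᵇ ∣ X ∣ in s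
  ... | false = subst (suc (length π) <_) (sym (length-++ (indCell v X)))
    (+-mono-≤-< (Parts-length≥1 (indCell-Parts v i) i) (ind-length is p))
  ... | true with lookup X v | indCell-Parts v i
  ind-length {X ∷ π} {v} (i ∷ is) refl | true | true | P with ∣ X ─ ⁅ v ⁆ ∣ ≡ᵇ 0
  -- With an empty remainder `X` would have the size of a singleton.
  ... | true  = contradiction (≤ᵇ⇒≤ 2 ∣ X ∣ (T⁺ s)) (<⇒≱ (s≤s (≤-reflexive
    (trans (sym (Parts-size P)) (trans (+-identityʳ _) (Subset.∣⁅x⁆∣≡1 v))))))
  ... | false = s≤s (s≤s (Refines-length is (ind-Refines is v)))

  Rbar-length : ∀ ν {w} → lookup (Tbar ν) w ≡ true → length (Rbar ν) < length (Rbar (ν ∷ʳ w))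
  Rbar-length ν {w} p = ≤-trans (ind-length is p)
    (Refines-length (Refines-inhabited (ind-Refines is w)) (Rbar-∷ʳ-Refines ν w))
    where is = isInhabited (facts ν)

  -- An individualized vertex keeps its position: it depends only on the number
  -- of singleton cells in front of the target cell.
  col-individualized : ∀ {π v ρ} → Disjoint π → lookup (firstNonSingleton π) v ≡ true →
    Refines (ind π v) ρ → col ρ v ≡ lead π
  col-individualized {[]} {v} D p r = contradiction (trans (sym p) (Vec.lookup-replicate v false)) λ ()
  col-individualized {X ∷ π} {v} D p r with 2 ≤ᵇ ∣ X ∣ in s | lookup X v in q
  col-individualized {X ∷ π} {v} D p (P ∷ r) | true | true =
    n≤0⇒n≡0 (≤-pred (≤-trans (col-Parts-inside P (lookup-⁅⁆ v))
      (≤-trans (Parts-length≤size P) (≤-reflexive (Subset.∣⁅x⁆∣≡1 v)))))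
  col-individualized D p r | true | false = contradiction (trans (sym p) q) λ ()
  col-individualized {X ∷ π} D p r | false | true =
    contradiction p (Disjoint-head D (target-∈ π p) q)
  col-individualized {X ∷ π} {v} D p (_∷_ {Fs = Fs} P r) | false | false =
    trans (col-Parts-outside P q) (cong₂ _+_
      (≤-antisym (≤-trans (Parts-length≤size P) (≤-pred (≤ᵇ-false 2 _ s)))
        (Parts-length≥1 P (All.head (nonempty D))))
      (col-individualized (Disjoint-tail D) p r))

  -- `child` appends at the end, so `τ` is inspected from its end: if it is empty, `x` is the last
  -- vertex; otherwise both sequences lose their last vertex.
  Node-prefix : ∀ {ν} → Node ν → ∀ κ {x τ} → ν ≡ κ ++ x ∷ τ → Node κ × lookup (Tbar κ) x ≡ true
  Node-prefix root []      ()
  Node-prefix root (_ ∷ _) ()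
  Node-prefix (child {ν} N w w∈T) κ {x} {τ} e with reverseView τ
  ... | [] with ∷ʳ-injective ν κ e
  ...   | refl , refl = N , []=⇒lookup w∈T
  Node-prefix (child {ν} N w w∈T) κ {x} {τ} e | τ′ ∶ _ ∶ʳ z =
    Node-prefix N κ (proj₁ (∷ʳ-injective ν (κ ++ x ∷ τ′) (trans e (sym (++-assoc κ (x ∷ τ′) [ z ])))))

  child′ : ∀ {ν} → Node ν → ∀ {w} → lookup (Tbar ν) w ≡ true → Node (ν ∷ʳ w)
  child′ N {w} p = child N w (lookup⇒[]= w _ p)

  -- The number of cells grows at each level and never exceeds `n`, so a descent through arbitrary
  -- children stops at a leaf.
  leaf-below : ∀ k {ν} → Node ν → n < k + length (Rbar ν) → ∃ λ τ → Leaf (ν ++ τ)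
  leaf-below zero {ν} N l = contradiction (Disjoint-length (isDisjoint (facts ν))) (<⇒≱ l)
  leaf-below (suc k) {ν} N l with shape ν
  ... | leaf d = [] , subst Leaf (sym (++-identityʳ ν)) (N , d)
  ... | inner _ (w , w∈T) =
    let τ , L = leaf-below k (child′ N w∈T)
          (≤-trans l (≤-trans (≤-reflexive (sym (+-suc k _))) (+-monoʳ-≤ k (Rbar-length ν w∈T))))
    in w ∷ τ , subst Leaf (∷ʳ-++ ν w τ) L

  -- Invariants

  phi-∷ʳ : ∀ ν v → phi (ν ∷ʳ v) ≡ phi ν ∷ʳ hash G (Rbar (ν ∷ʳ v))
  phi-∷ʳ ν v = trans (cong (map (λ p → hash G (Rbar p))) (drop-inits-∷ʳ ν v))
    (map-++ (λ p → hash G (Rbar p)) (drop 1 (inits ν)) _)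

  phi-++ : ∀ ν τ → ∃ λ hs → phi (ν ++ τ) ≡ phi ν ++ hs
  phi-++-∷ : ∀ ν v τ → ∃ λ hs → phi (ν ++ v ∷ τ) ≡ phi ν ++ hash G (Rbar (ν ∷ʳ v)) ∷ hs
  phi-++ ν []      = [] , trans (cong phi (++-identityʳ ν)) (sym (++-identityʳ (phi ν)))
  phi-++ ν (v ∷ τ) = let hs , e = phi-++-∷ ν v τ in _ ∷ hs , e
  phi-++-∷ ν v τ with phi-++ (ν ∷ʳ v) τ
  ... | hs , e = hs , trans (cong phi (sym (∷ʳ-++ ν v τ)))
    (trans e (trans (cong (_++ hs) (phi-∷ʳ ν v)) (∷ʳ-++ (phi ν) _ hs)))

  -- Pruning everything off the canonical path

  module Pruning (<H-sto : IsStrictTotalOrder _≡_ _<H_) (<G-sto : IsStrictTotalOrder _≡_ _<G_)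
    {ν⋆ : Seq n} (canonical : CanonicalLeaf ν⋆) where

    private
      maximal : MaximalLeaf ν⋆
      maximal = proj₁ canonical
      N⋆ : Node ν⋆
      N⋆ = proj₁ (proj₁ maximal)
      d⋆ : Discrete (Rbar ν⋆)
      d⋆ = proj₂ (proj₁ maximal)

    -- A leaf below a child of `μ` would have an invariant that properly extends `phi ν⋆`, against
    -- maximality.
    no-longer-path : ∀ {μ} → Node μ → phi ν⋆ ≡ phi μ → ¬ Inhabited (Tbar μ)
    -- `suc n` exceeds the possible number of cells, so it suffices at every node.
    no-longer-path {μ} N e (w , w∈T) with leaf-below (suc n) (child′ N w∈T) (m≤m+n (suc n) _)
    ... | τ , L = proj₂ maximal _ L
      (subst₂ _<φ_ (sym e) (trans (sym (proj₂ ext)) (cong phi (sym (∷ʳ-++ μ w τ)))) (Lex-prefix (phi μ)))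
      where ext = phi-++-∷ μ w τ

    -- Otherwise any leaf below the child `w` would beat `ν⋆` at the entry following the common
    -- invariant.
    no-larger-hash : ∀ {μ κ x τ w} → Node μ → lookup (Tbar μ) w ≡ true → κ ++ x ∷ τ ≡ ν⋆ →
      phi κ ≡ phi μ → ¬ (hash G (Rbar (κ ∷ʳ x)) <H hash G (Rbar (μ ∷ʳ w)))
    no-larger-hash {μ} {κ} {x} {τ} {w} N w∈T refl e l
      with leaf-below (suc n) (child′ N w∈T) (m≤m+n (suc n) _)
    ... | τ′ , L with phi-++-∷ κ x τ | phi-++-∷ μ w τ′
    ...   | hs , φκ | hs′ , φμ = proj₂ maximal _ L (subst₂ _<φ_ (sym φκ)
      (trans (cong (_++ hash G (Rbar (μ ∷ʳ w)) ∷ hs′) e)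
        (trans (sym φμ) (cong phi (sym (∷ʳ-++ μ w τ′)))))
      (Lex-++ (phi κ) l))

    -- A leaf with the same graph as ν⋆ is the image of ν⋆ under the automorphism
    -- that matches the two discrete colorings: the image of ν⋆ has the same
    -- coloring as the leaf, and a leaf can be read off from its coloring.
    module Symmetric-leaf {ℓ : Seq n} (N : Node ℓ) (d : Discrete (Rbar ℓ))
      (G≡ : graphBy (Rbar ν⋆) G ≡ graphBy (Rbar ℓ) G) where

      private
        F⋆ = facts ν⋆
        F  = facts ℓ

      σ : Permutation′ n
      σ = matching (isPartition F⋆) (isPartition F) d⋆ d

      σ-IsAut : IsAut G π₀ σ
      σ-IsAut = matching-IsAut (isPartition F⋆) (isPartition F) d⋆ d
        (Partition⇒Disjoint P₀) (refines F⋆) (refines F) G≡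

      open Action σ
      open Equivariance G (adj-matching (isPartition F⋆) (isPartition F) d⋆ d G G≡)

      Rbar-[]-equivariant : Rbar [] ≡ map act (Rbar [])
      Rbar-[]-equivariant = Closure-deterministic Rbar-[]-Closure
        (subst (λ π → Closure G π (map act (Rbar []))) (proj₂ σ-IsAut) (act-Closure Rbar-[]-Closure))

      Rbar-∷ʳ-equivariant : ∀ κ μ x → Rbar μ ≡ map act (Rbar κ) →
        Rbar (μ ∷ʳ (σ ⟨$⟩ʳ x)) ≡ map act (Rbar (κ ∷ʳ x))
      Rbar-∷ʳ-equivariant κ μ x e = Closure-deterministic (Rbar-∷ʳ-Closure μ (σ ⟨$⟩ʳ x))
        (subst (λ π → Closure G π (map act (Rbar (κ ∷ʳ x))))
          (trans (sym (act-ind (Rbar κ) x)) (cong (λ π → ind π (σ ⟨$⟩ʳ x)) (sym e)))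
          (act-Closure (Rbar-∷ʳ-Closure κ x)))

      col-path : ∀ {ν} → Node ν → ∀ κ {x τ} → κ ++ x ∷ τ ≡ ν → col (Rbar ν) x ≡ lead (Rbar κ)
      col-path M κ {x} {τ} refl = col-individualized (isDisjoint (facts κ))
        (proj₂ (Node-prefix M κ refl))
        (Refines-trans (Rbar-∷ʳ-Refines κ x)
          (subst (Refines (Rbar (κ ∷ʳ x))) (cong Rbar (∷ʳ-++ κ x τ)) (Rbar-++-Refines (κ ∷ʳ x) τ)))

      -- Both paths are followed in parallel. Corresponding colorings have equal `lead`, so `x` in
      -- the coloring of `ν⋆` and `y` in that of `ℓ` have equal positions; thus `σ` maps `x` to `y`,
      -- and the next colorings correspond again.
      image : ∀ κ μ τ τ′ → κ ++ τ ≡ ν⋆ → μ ++ τ′ ≡ ℓ → length τ ≡ length τ′ →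
        Rbar μ ≡ map act (Rbar κ) → map (σ ⟨$⟩ʳ_) τ ≡ τ′
      image κ μ []      []       _ _ _ _ = refl
      image κ μ (x ∷ τ) (y ∷ τ′) p q l e = cong₂ _∷_ σx≡y
        (image (κ ∷ʳ x) (μ ∷ʳ y) τ τ′ (trans (∷ʳ-++ κ x τ) p) (trans (∷ʳ-++ μ y τ′) q) (suc-injective l)
          (subst (λ z → Rbar (μ ∷ʳ z) ≡ map act (Rbar (κ ∷ʳ x))) σx≡y (Rbar-∷ʳ-equivariant κ μ x e)))
        where
        σx≡y : σ ⟨$⟩ʳ x ≡ y
        σx≡y = col-injective (isPartition F) d (begin
          col (Rbar ℓ) (σ ⟨$⟩ʳ x)   ≡⟨ col-matching (isPartition F⋆) (isPartition F) d⋆ d x ⟩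
          col (Rbar ν⋆) x           ≡⟨ col-path N⋆ κ p ⟩
          lead (Rbar κ)             ≡⟨ act-lead (Rbar κ) ⟨
          lead (map act (Rbar κ))   ≡⟨ cong lead e ⟨
          lead (Rbar μ)             ≡⟨ col-path N μ q ⟨
          col (Rbar ℓ) y            ∎)
          where open ≡-Reasoning

      prune-symmetric : length ν⋆ ≡ length ℓ → ν⋆ <lex ℓ → Derivable (pruned ℓ)
      prune-symmetric l ν⋆<ℓ = pruneAutomorphism ν⋆ ℓ ν⋆<ℓ σ σ-IsAut
        (image [] [] ν⋆ ℓ refl refl l Rbar-[]-equivariant)

    maximal-leaf : ∀ {ℓ} → Node ℓ → Discrete (Rbar ℓ) → phi ν⋆ ≡ phi ℓ → MaximalLeaf ℓ
    maximal-leaf N d e = (N , d) , λ ν′ L → subst (λ p → ¬ (p <φ phi ν′)) e (proj₂ maximal ν′ L)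

    prune-leaf : ∀ {ℓ} → Node ℓ → Discrete (Rbar ℓ) → Derivable (φ≡ ν⋆ ℓ) → phi ν⋆ ≡ phi ℓ →
      length ν⋆ ≡ length ℓ → ν⋆ ≢ ℓ → Derivable (pruned ℓ)
    prune-leaf {ℓ} N d same-φ same-phi l ν⋆≢ℓ with IsStrictTotalOrder.compare <G-sto (Gν ℓ) (Gν ν⋆)
    ... | tri< G< _ _ = pruneLeaf (derivable (facts ν⋆)) (derivable (facts ℓ)) same-φ d (inj₂ G<)
    ... | tri> _ _ G> = contradiction G> (proj₁ (proj₂ canonical) ℓ (maximal-leaf N d same-phi))
    ... | tri≈ _ G≡ _ with Lex.<-compare sym Fin.<-cmp ν⋆ ℓ
    -- `ν⋆` is lexicographically least among the maximal leaves with its graph, so this order, the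
    -- one that PruneAutomorphism demands, is the only possible one.
    ...   | tri< ν⋆<ℓ _ _ = Symmetric-leaf.prune-symmetric N d (sym G≡) l ν⋆<ℓ
    ...   | tri≈ _ ν⋆≋ℓ _ = contradiction (Pointwise-≡⇒≡ ν⋆≋ℓ) ν⋆≢ℓ
    ...   | tri> _ _ ℓ<ν⋆ =
      contradiction ℓ<ν⋆ (proj₂ (proj₂ canonical) ℓ (maximal-leaf N d same-phi) G≡)

    -- Equality of invariants is kept twice: as a derived fact for the pruning rules, and as an
    -- equation for the appeals to maximality.
    record Rival (κ μ : Seq n) : Set where
      field
        node      : Node μ
        same-φ    : Derivable (φ≡ κ μ)
        same-phi  : phi κ ≡ phi μ
        same-size : length κ ≡ length μ
    open Rival

    -- `k` bounds the remaining depth, because the number of cells grows towards the leaves. Keeping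
    -- `κ ≢ μ` ensures that the descent never ends in `ν⋆` itself.
    prune-node : ∀ k {κ μ τ} → κ ++ τ ≡ ν⋆ → Rival κ μ → κ ≢ μ →
      n < k + length (Rbar μ) → Derivable (pruned μ)
    prune-child : ∀ k {κ μ x w τ} → κ ++ x ∷ τ ≡ ν⋆ → Rival κ μ → lookup (Tbar μ) w ≡ true →
      κ ∷ʳ x ≢ μ ∷ʳ w → n < k + length (Rbar (μ ∷ʳ w)) → Derivable (pruned (μ ∷ʳ w))

    prune-node zero {μ = μ} p R ≢μ l =
      contradiction (Disjoint-length (isDisjoint (facts μ))) (<⇒≱ l)
    prune-node (suc k) {κ} {μ} {τ} p R ≢μ l with shape μ
    prune-node (suc k) {κ} {μ} {[]} p R ≢μ l | leaf d with trans (sym (++-identityʳ κ)) p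
    ... | refl = prune-leaf (node R) d (same-φ R) (same-phi R) (same-size R) ≢μ
    -- The canonical path continues below `κ`, so `κ` is not a leaf, and PruneLeaf applies without
    -- comparing graphs.
    prune-node (suc k) {κ} {μ} {x ∷ τ} p R ≢μ l | leaf d =
      pruneLeaf (derivable (facts κ)) (derivable (facts μ)) (same-φ R) d
        (inj₁ λ dκ → Discrete-target dκ x (proj₂ (Node-prefix N⋆ κ (sym p))))
    -- Here `κ` is `ν⋆`, and the rival would lead to a longer invariant.
    prune-node (suc k) {κ} {μ} {[]} p R ≢μ l | inner _ i with trans (sym (++-identityʳ κ)) p
    ... | refl = contradiction i (no-longer-path (node R) (same-phi R))
    prune-node (suc k) {κ} {μ} {x ∷ τ} p R ≢μ l | inner t _ = pruneParent t λ w w∈T →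
      prune-child k p R ([]=⇒lookup w∈T) (≢μ ∘ proj₁ ∘ ∷ʳ-injective κ μ)
        (≤-trans l (≤-trans (≤-reflexive (sym (+-suc k _)))
          (+-monoʳ-≤ k (Rbar-length μ ([]=⇒lookup w∈T)))))

    prune-child k {κ} {μ} {x} {w} {τ} p R w∈T ≢μ l
      with IsStrictTotalOrder.compare <H-sto (hash G (Rbar (μ ∷ʳ w))) (hash G (Rbar (κ ∷ʳ x)))
    ... | tri< h< _ _ = pruneInvariant (same-φ R) (derivable (facts (κ ∷ʳ x)))
                          (derivable (facts (μ ∷ʳ w))) h<
    ... | tri> _ _ h> = contradiction h> (no-larger-hash (node R) w∈T p (same-phi R))
    ... | tri≈ _ h≡ _ = prune-node k (trans (∷ʳ-++ κ x τ) p) R′ ≢μ l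
      where
      R′ : Rival (κ ∷ʳ x) (μ ∷ʳ w)
      R′ = record
        { node      = child′ (node R) w∈T
        ; same-φ    = invariantsEqual (same-φ R) (derivable (facts (κ ∷ʳ x)))
                        (derivable (facts (μ ∷ʳ w))) (sym h≡)
        ; same-phi  = trans (phi-∷ʳ κ x) (trans (cong₂ _∷ʳ_ (same-phi R) (sym h≡)) (sym (phi-∷ʳ μ w)))
        ; same-size = trans (length-++ κ) (trans (cong (_+ 1) (same-size R)) (sym (length-++ μ)))
        }

    on-path : ∀ {κ} → Reverse κ → ∀ {τ} → κ ++ τ ≡ ν⋆ → Derivable (onPath κ)
    on-path []            p = pathAxiom
    on-path (κ ∶ rs ∶ʳ x) {τ} p with trans (sym (∷ʳ-++ κ x τ)) p
    ... | q with Node-prefix N⋆ κ (sym q)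
    ...   | Nκ , x∈T with shape κ
    ...     | leaf d    = contradiction x∈T (Discrete-target d x)
    ...     | inner t _ = extendPath (on-path rs q) t x λ w w∈T w≢x →
      prune-child (suc n) q R ([]=⇒lookup w∈T) (w≢x ∘ sym ∘ proj₂ ∘ ∷ʳ-injective κ κ) (m≤m+n (suc n) _)
      where
      -- `κ` is its own rival, so the siblings of `x` are compared with `x` below the same parent.
      R : Rival κ κ
      R = record { node = Nκ ; same-φ = invariantAxiom κ ; same-phi = refl ; same-size = refl }

    canonical-form-derivable : Derivable (C≡ (graphBy (Rbar ν⋆) G) (colBy (Rbar ν⋆) π₀))
    canonical-form-derivable =
      canonicalLeaf (on-path (reverseView ν⋆) (++-identityʳ ν⋆)) (derivable (facts ν⋆)) d⋆

theorem4p22 : ∀ {n : ℕ} (G : Graph n) → Symmetric G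
    → (π₀ : Coloring n) → IsColoring π₀
    → (H : Set) (_<H_ : Rel H 0ℓ) → IsStrictTotalOrder _≡_ _<H_
    → (hash : Graph n → Coloring n → H) → HashInvariant hash
    → (_<G_ : Rel (Graph n) 0ℓ) → IsStrictTotalOrder _≡_ _<G_
    → (G' : Graph n) (π' : Coloring n)
    → Canon.IsCanonicalForm G π₀ _<H_ hash _<G_ G' π'
    → Canon.Derivable G π₀ _<H_ hash _<G_ (C≡ G' π')
theorem4p22 G _ π₀ c H _<H_ <H-sto hash _ _<G_ <G-sto _ _ (ν , canonical , refl , refl) =
  SearchTree.Pruning.canonical-form-derivable G π₀ (IsColoring⇒Partition c) _<H_ hash _<G_
    <H-sto <G-sto canonical
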